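{- For every singular cardinal $\lambda$ of countable cofinality there is a $(\lambda,\lambda^+)$-graph of type $T_\lambda$ that does not have an $(\aleph_0,\lambda^+)$-subgraph.
   Context: For infinite cardinals $\lambda<\kappa$, a $(\lambda,\kappa)$-graph is a bipartite graph with bipartition $(A,B)$, $|A|=\lambda$, $|B|=\kappa$, in which every $b\in B$ has infinitely many neighbours in $A$. An $(\lambda',\kappa)$-subgraph of it is a subgraph with bipartition $(C,D)$, $C\subseteq A$, $D\subseteq B$, that is itself a $(\lambda',\kappa)$-graph. For a cardinal $\lambda$, $T_\lambda$ is the order tree of all sequences of elements of $\lambda$ of length at most $\omega$ (including the empty sequence), ordered by initial segment; $T_\lambda^{<\omega}$ consists of the finite sequences and $T_\lambda^\omega$ of the $\omega$-sequences. For $\kappa>\lambda$, the down-closure $T$ of a $\kappa$-sized set $X\subseteq T_\lambda^\omega$ is a $\lambda$-tree with $\kappa$ tops (the tops being the elements of $X$). A $T$-graph is a graph with vertex set $T$ in which the endvertices of every edge are comparable and for every $t$ the neighbours of $t$ below $t$ are cofinal in $\{s : s<t\}$. A $(\lambda,\kappa)$-graph of type $T_\lambda$ is the bipartite graph with bipartition classes $T^{<\omega}$ and $X$ formed by the edges between these sets of some $T$-graph, where $T$ is a $\lambda$-tree with $\kappa$ tops $X$. -}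

module Defs where

open import Axiom.ExcludedMiddle using (ExcludedMiddle)
open import Axiom.Extensionality.Propositional using (Extensionality)
open import Data.Fin.Base using (Fin; toℕ; fromℕ<)
open import Data.Fin.Properties using (toℕ-injective; toℕ-fromℕ<; injective⇒≤)
open import Data.List.Base using (List; applyUpTo)
open import Data.List.Membership.Propositional using () renaming (_∈_ to _∈ᴸ_)
open import Data.List.Relation.Binary.Prefix.Heterogeneous using (Prefix)
open import Data.Nat.Base as ℕ using (ℕ; suc)
import Data.Nat.Properties as ℕₚ
import Data.Nat.Induction as ℕᵢ
open import Data.Product.Base using (Σ; Σ-syntax; ∃; ∃-syntax; _×_; _,_; proj₁; proj₂)
open import Data.Sum.Base using (_⊎_)
open import Function.Base using (_∘_)
open import Function.Bundles using (_↣_; _⇔_; Injection)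
open import Induction.WellFounded using (WellFounded)
open import Level using (Level; Setω; 0ℓ; _⊔_) renaming (suc to lsuc)
open import Relation.Binary.Core using (Rel; REL)
open import Relation.Binary.Definitions using (Symmetric; Irreflexive)
open import Relation.Binary.PropositionalEquality
open import Relation.Binary.Structures using (IsStrictTotalOrder)
open import Relation.Nullary.Negation using (¬_)
open import Relation.Unary using (Pred; _∈_; _⊆_; _∩_; _⊥_; U)

private variable
  a b ℓ p : Level

-- The ambient classical set theory.  `ExcludedMiddle` decides arbitrary types,
-- not only propositions: it turns ¬ ¬-existence into a chosen witness,
-- uniformly in parameters, and so also provides the axiom of choice.

record Classical : Setω where
  field
    em     : ∀ {a} → ExcludedMiddle a
    funext : ∀ {a b} → Extensionality a b

Infinite : {A : Set a} → Pred A p → Set (a ⊔ p)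
Infinite {A = A} P = ¬ (Σ[ xs ∈ List A ] P ⊆ (_∈ᴸ xs))

-- A cardinal is an initial ordinal: a well-order that does not inject into
-- any of its proper initial segments.

record Cardinal (ℓ : Level) : Set (lsuc ℓ) where
  field
    Carrier            : Set ℓ
    _<_                : Rel Carrier ℓ
    isStrictTotalOrder : IsStrictTotalOrder _≡_ _<_
    wellFounded        : WellFounded _<_
    initial            : ∀ x → ¬ (Σ[ f ∈ Carrier ↣ Carrier ] ∀ y → Injection.to f y < x)

∣_∣ : Cardinal ℓ → Set ℓ
∣_∣ = Cardinal.Carrier

ℵ₀ : Cardinal 0ℓ
ℵ₀ = record
  { Carrier            = ℕ
  ; _<_                = ℕ._<_
  ; isStrictTotalOrder = ℕₚ.<-isStrictTotalOrder
  ; wellFounded        = ℕᵢ.<-wellFounded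
  ; initial            = noInjection
  }
  where
  noInjection : ∀ n → ¬ (Σ[ f ∈ ℕ ↣ ℕ ] ∀ m → Injection.to f m ℕ.< n)
  noInjection n (f , f<n) = ℕₚ.1+n≰n (injective⇒≤ {f = g} g-injective)
    where
    g : Fin (suc n) → Fin n
    g i = fromℕ< (f<n (toℕ i))

    g-injective : ∀ {i j} → g i ≡ g j → i ≡ j
    g-injective {i} {j} eq = toℕ-injective (Injection.injective f
      (trans (sym (toℕ-fromℕ< (f<n (toℕ i))))
        (trans (cong toℕ eq) (toℕ-fromℕ< (f<n (toℕ j))))))

infix 4 _≤ᶜ_ _<ᶜ_

_≤ᶜ_ : Cardinal a → Cardinal b → Set (a ⊔ b)
μ ≤ᶜ ν = ∣ μ ∣ ↣ ∣ ν ∣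

_<ᶜ_ : Cardinal a → Cardinal b → Set (a ⊔ b)
μ <ᶜ ν = μ ≤ᶜ ν × ¬ (ν ≤ᶜ μ)

InfiniteCardinal : Cardinal ℓ → Set ℓ
InfiniteCardinal μ = Infinite (U {A = ∣ μ ∣})

IsSuccessor : (μ κ : Cardinal ℓ) → Set (lsuc ℓ)
IsSuccessor {ℓ} μ κ = μ <ᶜ κ × (∀ (ν : Cardinal ℓ) → μ <ᶜ ν → κ ≤ᶜ ν)

-- Cardinalities of subsets are expressed by maps into the ambient type rather
-- than into `Σ A P`, since P need not be proof-irrelevant.

HasCard : {A : Set a} → Pred A p → Cardinal b → Set (a ⊔ p ⊔ b)
HasCard {A = A} P μ =
  Σ[ f ∈ ∣ μ ∣ ↣ A ] ∀ x → x ∈ P ⇔ (∃[ i ] Injection.to f i ≡ x)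

HasCardAtLeast : {A : Set a} → Pred A p → Cardinal b → Set (a ⊔ p ⊔ b)
HasCardAtLeast {A = A} P μ = Σ[ f ∈ ∣ μ ∣ ↣ A ] ∀ i → Injection.to f i ∈ P

Cofinal : (μ : Cardinal ℓ) → Pred ∣ μ ∣ ℓ → Set ℓ
Cofinal μ P = ∀ x → ∃[ y ] y ∈ P × (x < y ⊎ x ≡ y)
  where open Cardinal μ

HasCofinality : Cardinal ℓ → Cardinal b → Set (lsuc ℓ ⊔ b)
HasCofinality {ℓ} μ ν =
    (Σ[ P ∈ Pred ∣ μ ∣ ℓ ] Cofinal μ P × HasCard P ν)
  × (∀ (P : Pred ∣ μ ∣ ℓ) → Cofinal μ P → HasCardAtLeast P ν)

Singular : Cardinal ℓ → Set (lsuc ℓ)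
Singular {ℓ} μ =
  InfiniteCardinal μ × (Σ[ ν ∈ Cardinal ℓ ] HasCofinality μ ν × ν <ᶜ μ)

-- Bipartite graphs whose vertices lie in an ambient type W; an edge is
-- recorded with its endvertex in A first.

record BipartiteGraph (W : Set ℓ) : Set (lsuc ℓ) where
  field
    A B      : Pred W ℓ
    disjoint : A ⊥ B
    E        : Rel W ℓ
    E⊆A×B    : ∀ {x y} → E x y → x ∈ A × y ∈ B

record _IsSubgraphOf_ {W : Set ℓ} (H G : BipartiteGraph W) : Set ℓ where
  private
    module H = BipartiteGraph H
    module G = BipartiteGraph G
  field
    A⊆A : H.A ⊆ G.A
    B⊆B : H.B ⊆ G.B
    E⊆E : ∀ {x y} → H.E x y → G.E x y

record Is⟨_,_⟩Graph {W : Set ℓ} (μ : Cardinal a) (κ : Cardinal b)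
                    (G : BipartiteGraph W) : Set (ℓ ⊔ a ⊔ b) where
  open BipartiteGraph G
  field
    infinite   : InfiniteCardinal μ
    less       : μ <ᶜ κ
    ∣A∣        : HasCard A μ
    ∣B∣        : HasCard B κ
    neighbours : ∀ {y} → y ∈ B → Infinite (λ x → E x y)

Has⟨_,_⟩Subgraph : {W : Set ℓ} → Cardinal a → Cardinal b → BipartiteGraph W →
                   Set (lsuc ℓ ⊔ a ⊔ b)
Has⟨ μ , κ ⟩Subgraph G = ∃[ H ] H IsSubgraphOf G × Is⟨ μ , κ ⟩Graph H

data Seq (L : Set ℓ) : Set ℓ where
  fin : List L → Seq L
  inf : (ℕ → L) → Seq L

module _ {L : Set ℓ} where

  infix 4 _⊑_ _⊏_

  data _⊑_ : Rel (Seq L) ℓ where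
    fin⊑fin : ∀ {xs ys} → Prefix _≡_ xs ys → fin xs ⊑ fin ys
    fin⊑inf : ∀ n f → fin (applyUpTo f n) ⊑ inf f
    inf⊑inf : ∀ f → inf f ⊑ inf f

  _⊏_ : Rel (Seq L) ℓ
  s ⊏ t = s ⊑ t × s ≢ t

  IsFinite : Pred (Seq L) ℓ
  IsFinite s = ∃[ xs ] s ≡ fin xs

  IsOmega : Pred (Seq L) ℓ
  IsOmega s = ∃[ f ] s ≡ inf f

  finite⊥omega : IsFinite ⊥ IsOmega
  finite⊥omega ((_ , refl) , (_ , ()))

  ↓_ : Pred (Seq L) ℓ → Pred (Seq L) ℓ
  (↓ X) s = ∃[ x ] x ∈ X × s ⊑ x

  record TGraph (T : Pred (Seq L) ℓ) : Set (lsuc ℓ) where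
    field
      _~_         : Rel (Seq L) ℓ
      ~-vertices  : ∀ {s t} → s ~ t → s ∈ T × t ∈ T
      ~-sym       : Symmetric _~_
      ~-irrefl    : Irreflexive _≡_ _~_
      comparable  : ∀ {s t} → s ~ t → s ⊑ t ⊎ t ⊑ s
      cofinal     : ∀ {s t} → s ∈ T → t ∈ T → s ⊏ t →
                    ∃[ u ] u ~ t × u ⊏ t × s ⊑ u

-- A μ-tree with κ tops, given by its set of tops.
record TreeWithTops (μ : Cardinal ℓ) (κ : Cardinal b) : Set (lsuc ℓ ⊔ b) where
  field
    less   : μ <ᶜ κ
    X      : Pred (Seq ∣ μ ∣) ℓ
    X⊆ω    : X ⊆ IsOmega
    ∣X∣    : HasCard X κ

  T : Pred (Seq ∣ μ ∣) ℓ
  T = ↓ X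

  T<ω : Pred (Seq ∣ μ ∣) ℓ
  T<ω = T ∩ IsFinite

module _ {μ : Cardinal ℓ} {κ : Cardinal b} where

  bipartiteOf : (τ : TreeWithTops μ κ) → TGraph (TreeWithTops.T τ) →
                BipartiteGraph (Seq ∣ μ ∣)
  bipartiteOf τ Γ = record
    { A        = T<ω
    ; B        = X
    ; disjoint = λ { ((_ , s-fin) , s∈X) → finite⊥omega (s-fin , X⊆ω s∈X) }
    ; E        = λ s x → s ∈ T<ω × x ∈ X × s ~ x
    ; E⊆A×B    = λ { (s∈T<ω , x∈X , _) → s∈T<ω , x∈X }
    }
    where
    open TreeWithTops τ
    open TGraph Γ

Is⟨_,_⟩GraphOfTypeT : (μ : Cardinal ℓ) (κ : Cardinal b) →
                      BipartiteGraph (Seq ∣ μ ∣) → Set (lsuc ℓ ⊔ b)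
Is⟨ μ , κ ⟩GraphOfTypeT G =
    Is⟨ μ , κ ⟩Graph G
  × (Σ[ τ ∈ TreeWithTops μ κ ] Σ[ Γ ∈ TGraph (TreeWithTops.T τ) ] G ≡ bipartiteOf τ Γ)

{-# OPTIONS --safe #-}

-- Write λ as the limit of cardinals d n and let R n be the successor of d n.
-- Along λ⁺ choose f α ∈ ∏ R n, increasing modulo finite sets, such that f δ
-- also dominates everywhere the functions indexed by a club of δ whenever δ has
-- cofinality ℵ₃.  The tops of the tree are the sequences f α, preceded by one more
-- entry, and each top is adjacent to all its initial segments.
--
-- If λ⁺ many tops had infinitely many neighbours in a countable set, their
-- entries would all lie in a countable set.  But every unbounded U ⊆ λ⁺ contains
-- uncountably many indices along which some coordinate of f is strictly
-- increasing (Shelah).  To find them, build an increasing ℵ₃-sequence in U,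
-- at each step passing an f that dominates the suprema, over the initial segments
-- of a club guessing sequence, of what was built so far, if there is one.  At the
-- end δ, the club attached to δ provides such suprema, and a member of the
-- guessing sequence lies inside it.
module Submission where

open import Defs
open import Data.Empty using (⊥; ⊥-elim)
open import Data.Fin.Base using (Fin; toℕ)
open import Data.Fin.Properties using (toℕ-injective; injective⇒≤)
open import Data.Irrelevant using ([_])
open import Data.List.Base using (List; []; _∷_; length; lookup; applyUpTo)
open import Data.List.Membership.Propositional using () renaming (_∈_ to _∈ᴸ_)
open import Data.List.Membership.Propositional.Properties using (∈-applyUpTo⁺)
open import Data.List.Properties using (∷-injective; length-applyUpTo)
open import Data.List.Relation.Binary.Pointwise as Pointwise using ()
open import Data.List.Relation.Binary.Prefix.Heterogeneous.Properties using (fromPointwise)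
open import Data.List.Relation.Unary.Any using (index)
open import Data.List.Relation.Unary.Any.Properties using (lookup-index)
open import Data.Nat.Base as ℕ using (ℕ; zero; suc)
import Data.Nat.Induction as ℕᵢ
import Data.Nat.Properties as ℕₚ
open import Data.Product.Base using (Σ-syntax; ∃; ∃-syntax; _×_; _,_; proj₁; proj₂)
open import Data.Product.Function.NonDependent.Propositional using (_×-↣_)
open import Data.Product.Relation.Binary.Lex.Strict
  using (×-Lex; ×-transitive; ×-compare; ×-wellFounded)
open import Data.Refinement using (Refinement; Refinement-syntax; _,_)
open import Data.Sum.Base using (_⊎_; inj₁; inj₂; swap)
open import Data.Sum.Function.Propositional using (_⊎-↣_)
open import Data.Sum.Properties using (inj₁-injective; inj₂-injective)
open import Data.Sum.Relation.Binary.LeftOrder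
  using (_⊎-<_; ₁∼₂; ₁∼₁; ₂∼₂; ⊎-<-transitive; ⊎-<-wellFounded; drop-inj₁; drop-inj₂)
open import Function.Base using (_∘_; id; _on_)
open import Function.Bundles using (_↣_; mk↣; Injection; mk⇔; Equivalence)
open import Function.Construct.Composition using (_↣-∘_)
open import Function.Construct.Identity using (↣-id)
open import Induction.WellFounded using (WellFounded; module All; module FixPoint; wf⇒asym)
open import Level using (Level; _⊔_) renaming (suc to lsuc)
open import Relation.Binary.Construct.On using () renaming (wellFounded to on-wellFounded)
open import Relation.Binary.Core using (Rel)
open import Relation.Binary.Definitions using (Transitive; Trichotomous; Tri; tri<; tri≈; tri>)
open import Relation.Binary.PropositionalEquality
open import Relation.Binary.Structures using (IsStrictTotalOrder)
open import Relation.Binary.Structures.Biased using (isStrictTotalOrderᶜ)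
open import Relation.Nullary.Decidable.Core using (Dec; yes; no; decidable-stable; recompute)
open import Relation.Nullary.Negation using (¬_; contradiction)
open import Relation.Unary using (Pred; _∈_)

open Injection using (to; injective)

private variable
  a b c ℓ p : Level
  A : Set a
  B : Set b

infixr 9 _↣∘_
_↣∘_ : {C : Set c} → B ↣ C → A ↣ B → A ↣ C
_↣∘_ = _↣-∘_

-- Well-orders

record WellOrder (ℓ : Level) : Set (lsuc ℓ) where
  infix 4 _<_ _≮_
  field
    Carrier     : Set ℓ
    _<_         : Rel Carrier ℓ
    <-trans     : Transitive _<_
    compare     : Trichotomous _≡_ _<_
    wellFounded : WellFounded _<_

  _≮_ : Rel Carrier ℓ
  x ≮ y = ¬ (x < y)

  <-irrefl : ∀ {x} → x ≮ x
  <-irrefl x<x = wf⇒asym wellFounded x<x x<x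

  <-asym : ∀ {x y} → x < y → y ≮ x
  <-asym = wf⇒asym wellFounded

  ≮-antisym : ∀ {x y} → x ≮ y → y ≮ x → x ≡ y
  ≮-antisym {x} {y} x≮y y≮x with compare x y
  ... | tri< x<y _ _ = contradiction x<y x≮y
  ... | tri≈ _ x≡y _ = x≡y
  ... | tri> _ _ y<x = contradiction y<x y≮x

  <-≮-trans : ∀ {x y z} → x < y → z ≮ y → x < z
  <-≮-trans {x} {y} {z} x<y z≮y with compare x z
  ... | tri< x<z _ _ = x<z
  ... | tri≈ _ refl _ = contradiction x<y z≮y
  ... | tri> _ _ z<x = contradiction (<-trans z<x x<y) z≮y

  ≮-<-trans : ∀ {x y z} → y ≮ x → y < z → x < z
  ≮-<-trans {x} {y} {z} y≮x y<z with compare x y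
  ... | tri< x<y _ _ = <-trans x<y y<z
  ... | tri≈ _ refl _ = y<z
  ... | tri> _ _ y<x = contradiction y<x y≮x

  upperBound₂ : ∀ x y → ∃[ z ] z ≮ x × z ≮ y
  upperBound₂ x y with compare x y
  ... | tri< x<y _ _ = y , <-asym x<y , <-irrefl
  ... | tri≈ _ refl _ = x , <-irrefl , <-irrefl
  ... | tri> _ _ y<x = x , <-irrefl , <-asym y<x

⟦_⟧ : WellOrder ℓ → Set ℓ
⟦_⟧ = WellOrder.Carrier

pullback : (W : WellOrder ℓ) {A : Set ℓ} → A ↣ ⟦ W ⟧ → WellOrder ℓ
pullback W {A} f = record
  { Carrier     = A
  ; _<_         = _<_ on to f
  ; <-trans     = <-trans
  ; compare     = cmp
  ; wellFounded = on-wellFounded (to f) wellFounded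
  }
  where
  open WellOrder W
  cmp : Trichotomous _≡_ (_<_ on to f)
  cmp x y with compare (to f x) (to f y)
  ... | tri< l n g = tri< l (n ∘ cong (to f)) g
  ... | tri≈ l e g = tri≈ l (injective f e) g
  ... | tri> l n g = tri> l (n ∘ cong (to f)) g

ℕ-wo : WellOrder _
ℕ-wo = record
  { <-trans = ℕₚ.<-trans ; compare = ℕₚ.<-cmp ; wellFounded = ℕᵢ.<-wellFounded }

cardinal-wo : Cardinal ℓ → WellOrder ℓ
cardinal-wo μ = record
  { <-trans = trans′ ; compare = compare ; wellFounded = wellFounded }
  where
  open Cardinal μ
  open IsStrictTotalOrder isStrictTotalOrder using (compare) renaming (trans to trans′)

ℕ⊎-wo : WellOrder ℓ → WellOrder ℓ
ℕ⊎-wo W = record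
  { Carrier     = ℕ ⊎ ⟦ W ⟧
  ; _<_         = ℕ._<_ ⊎-< _<_
  ; <-trans     = ⊎-<-transitive ℕₚ.<-trans <-trans
  ; compare     = cmp
  ; wellFounded = ⊎-<-wellFounded ℕᵢ.<-wellFounded wellFounded
  }
  where
  open WellOrder W
  cmp : Trichotomous _≡_ (ℕ._<_ ⊎-< _<_)
  cmp (inj₁ m) (inj₁ n) with ℕₚ.<-cmp m n
  ... | tri< l e g = tri< (₁∼₁ l) (e ∘ inj₁-injective) (g ∘ drop-inj₁)
  ... | tri≈ l e g = tri≈ (l ∘ drop-inj₁) (cong inj₁ e) (g ∘ drop-inj₁)
  ... | tri> l e g = tri> (l ∘ drop-inj₁) (e ∘ inj₁-injective) (₁∼₁ g)
  cmp (inj₁ m) (inj₂ y) = tri< ₁∼₂ (λ ()) (λ ())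
  cmp (inj₂ x) (inj₁ n) = tri> (λ ()) (λ ()) ₁∼₂
  cmp (inj₂ x) (inj₂ y) with compare x y
  ... | tri< l e g = tri< (₂∼₂ l) (e ∘ inj₂-injective) (g ∘ drop-inj₂)
  ... | tri≈ l e g = tri≈ (l ∘ drop-inj₂) (cong inj₂ e) (g ∘ drop-inj₂)
  ... | tri> l e g = tri> (l ∘ drop-inj₂) (e ∘ inj₂-injective) (₂∼₂ g)

lex-wo : WellOrder ℓ → WellOrder ℓ → WellOrder ℓ
lex-wo V W = record
  { Carrier     = ⟦ V ⟧ × ⟦ W ⟧
  ; _<_         = ×-Lex _≡_ V._<_ W._<_
  ; <-trans     = λ {x} {y} {z} →
      ×-transitive isEquivalence (resp₂ V._<_) V.<-trans W.<-trans {x} {y} {z}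
  ; compare     = cmp
  ; wellFounded = ×-wellFounded V.wellFounded W.wellFounded
  }
  where
  module V = WellOrder V
  module W = WellOrder W
  cmp : Trichotomous _≡_ (×-Lex _≡_ V._<_ W._<_)
  cmp x y with ×-compare sym V.compare W.compare x y
  ... | tri< l e g = tri< l (e ∘ λ { refl → refl , refl }) g
  ... | tri≈ l (refl , refl) g = tri≈ l refl g
  ... | tri> l e g = tri> l (e ∘ λ { refl → refl , refl }) g

-- The code of `(m , n)` is 2^m (2n + 1).
pairing : (ℕ × ℕ) ↣ ℕ
pairing = mk↣ {to = λ (m , n) → pair m n} λ {x} {y} → pair-injective (proj₁ x) (proj₁ y)
  where
  pair : ℕ → ℕ → ℕ
  pair zero    n = suc (2 ℕ.* n)
  pair (suc m) n = 2 ℕ.* pair m n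

  pair-injective : ∀ m m′ {n n′} → pair m n ≡ pair m′ n′ → (m , n) ≡ (m′ , n′)
  pair-injective zero    zero     {n} {n′} eq =
    cong (0 ,_) (ℕₚ.*-cancelˡ-≡ n n′ 2 (ℕₚ.suc-injective eq))
  pair-injective zero    (suc m′) {n} {n′} eq = contradiction (sym eq) (ℕₚ.even≢odd (pair m′ n′) n)
  pair-injective (suc m) zero     {n} {n′} eq = contradiction eq (ℕₚ.even≢odd (pair m n) n′)
  pair-injective (suc m) (suc m′) {n} {n′} eq
    with pair-injective m m′ (ℕₚ.*-cancelˡ-≡ (pair m n) (pair m′ n′) 2 eq)
  ... | refl = refl

-- The proof of `below` is irrelevant, so that equality of segment elements is
-- equality of their values.
record Seg (W : WellOrder ℓ) (x : ⟦ W ⟧) : Set ℓ where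
  constructor seg
  field
    value  : ⟦ W ⟧
    .below : WellOrder._<_ W value x
open Seg using (value)

value-injection : (W : WellOrder ℓ) (x : ⟦ W ⟧) → Seg W x ↣ ⟦ W ⟧
value-injection W x = mk↣ {to = value} λ { {seg _ _} {seg _ _} refl → refl }

Seg-wo : (W : WellOrder ℓ) → ⟦ W ⟧ → WellOrder ℓ
Seg-wo W x = pullback W (value-injection W x)

Seg-flatten : (W : WellOrder ℓ) → ∀ {x} (s : Seg W x) → Seg (Seg-wo W x) s ↣ Seg W (value s)
Seg-flatten W s = mk↣ {to = λ { (seg (seg y _) y<s) → seg y y<s }}
  λ { {seg (seg _ _) _} {seg (seg _ _) _} refl → refl }

Seg-unflatten : (W : WellOrder ℓ) → ∀ {x} (s : Seg W x) → Seg W (value s) ↣ Seg (Seg-wo W x) s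
Seg-unflatten W (seg _ s<x) = mk↣
  {to = λ { (seg y y<s) → seg (seg y (WellOrder.<-trans W y<s s<x)) y<s }}
  λ { {seg _ _} {seg _ _} refl → refl }

Seg-mono : (W : WellOrder ℓ) → ∀ {x y} → WellOrder._≮_ W y x → Seg W x ↣ Seg W y
Seg-mono W x≤y = mk↣ {to = λ { (seg z z<x) → seg z (WellOrder.<-≮-trans W z<x x≤y) }}
  λ { {seg _ _} {seg _ _} refl → refl }

Bounded : (W : WellOrder ℓ) {J : Set b} → (J → ⟦ W ⟧) → Set (ℓ ⊔ b)
Bounded W g = ∃[ x ] ∀ j → WellOrder._<_ W (g j) x

-- For an infinite well-orderable `A` this makes `W` an initial ordinal of size |A|⁺. Phrasing it by
-- injections lets segments of a larger order stand on either side.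
record IsSuccessorOf (A : Set a) (W : WellOrder ℓ) : Set (a ⊔ ℓ) where
  field
    segments : ∀ x → Seg W x ↣ A
    larger   : ¬ (⟦ W ⟧ ↣ A)

module Classically (classical : Classical) where
  open Classical classical

  -- Least elements, transfinite recursion with choices, comparability

  byContradiction : ¬ ¬ A → A
  byContradiction = decidable-stable em

  ¬∀⟶∃¬ : {P : A → Set p} → ¬ (∀ x → P x) → ∃[ x ] ¬ P x
  ¬∀⟶∃¬ ¬∀ = byContradiction λ ¬∃ → ¬∀ λ x → byContradiction λ ¬Px → ¬∃ (x , ¬Px)

  module _ (W : WellOrder ℓ) where
    open WellOrder W


    -- Excluded middle recovers the bound from its irrelevant proof.
    below : ∀ {x} (s : Seg W x) → value s < x
    below (seg _ p) = recompute em p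

    abstract
      least : (P : ⟦ W ⟧ → Set p) → ∃ P → ∃[ x ] P x × (∀ y → P y → y ≮ x)
      least P (x , Px) = byContradiction λ none →
        All.wfRec wellFounded _ (λ x → ¬ P x)
          (λ x ih Px → none (x , Px , λ y Py y<x → ih y<x Py)) x Px

    module _ {B : Set b} (P : ∀ x → (Seg W x → B) → B → Set p) (step : ∀ x g → ∃ (P x g)) where
      private
        restrict : ∀ x → (∀ {y} → y < x → B) → Seg W x → B
        restrict x rec s = rec (below s)

        body : ∀ x → (∀ {y} → y < x → B) → B
        body x rec = proj₁ (step x (restrict x rec))

        open FixPoint wellFounded (λ _ → B) body
          (λ x eq → cong (λ g → proj₁ (step x g)) (funext λ s → eq (below s)))

        f : ⟦ W ⟧ → B
        f = All.wfRec wellFounded _ _ body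

      abstract
        -- `P` relates each value to the earlier ones, so that a construction with choices is used
        -- through its specification alone. `funext` supplies the congruence by which the fixed
        -- point unfolds.
        recursion : Σ[ f ∈ (⟦ W ⟧ → B) ] ∀ x → P x (f ∘ value) (f x)
        recursion = f , λ x →
          subst (P x (f ∘ value)) (sym unfold-wfRec) (proj₂ (step x (f ∘ value)))

    -- If some segment of `W` maps onto `B`, a choice of preimages embeds `B` in it. Otherwise the
    -- recursion always finds a value not yet taken.
    dichotomy : (B : Set b) → (⟦ W ⟧ ↣ B) ⊎ (∃[ x ] B ↣ Seg W x)
    dichotomy B with em {P = ∃[ x ] Σ[ g ∈ (Seg W x → B) ] ∀ y → ∃[ s ] g s ≡ y}
    ... | yes (x , g , onto) =
      inj₂ (x , mk↣ {to = λ y → proj₁ (onto y)} λ {y} {z} eq →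
        trans (sym (proj₂ (onto y))) (trans (cong g eq) (proj₂ (onto z))))
    ... | no ¬onto = inj₁ (mk↣ {to = f} f-injective)
      where
      fresh : ∀ x (g : Seg W x → B) → ∃[ y ] ∀ s → g s ≢ y
      fresh x g = byContradiction λ none → ¬onto (x , g , λ y →
        byContradiction λ ¬s → none (y , λ s eq → ¬s (s , eq)))

      f = proj₁ (recursion (λ x g y → ∀ s → g s ≢ y) fresh)
      f-fresh = proj₂ (recursion (λ x g y → ∀ s → g s ≢ y) fresh)

      f-injective : ∀ {x y} → f x ≡ f y → x ≡ y
      f-injective {x} {y} eq with compare x y
      ... | tri< x<y _ _ = contradiction eq (f-fresh y (seg x x<y))
      ... | tri≈ _ x≡y _ = x≡y
      ... | tri> _ _ y<x = contradiction (sym eq) (f-fresh x (seg y y<x))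

  -- Hilbert's hotel: the copy of ℕ inside `A` moves to its even places, and the new ℕ takes the odd
  -- ones.
  ℕ⊎-absorb : ℕ ↣ A → (ℕ ⊎ A) ↣ A
  ℕ⊎-absorb {A = A} e = mk↣ {to = f} f-injective
    where
    ev od : ℕ → A
    ev k = to e (2 ℕ.* k)
    od k = to e (suc (2 ℕ.* k))

    g : ∀ x → Dec (∃[ k ] to e k ≡ x) → A
    g x (yes (k , _)) = ev k
    g x (no _)        = x

    f : ℕ ⊎ A → A
    f (inj₁ k) = od k
    f (inj₂ x) = g x em

    od≢g : ∀ k y d → od k ≢ g y d
    od≢g k y (yes (l , _)) eq = ℕₚ.even≢odd l k (sym (injective e eq))
    od≢g k y (no ¬l)       eq = ¬l (_ , eq)

    g-injective : ∀ x y d d′ → g x d ≡ g y d′ → x ≡ y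
    g-injective x y (yes (k , p)) (yes (l , q)) eq =
      trans (sym p) (trans (cong (to e) (ℕₚ.*-cancelˡ-≡ k l 2 (injective e eq))) q)
    g-injective x y (yes _) (no ¬l) eq = contradiction (_ , eq) ¬l
    g-injective x y (no ¬k) (yes _) eq = contradiction (_ , sym eq) ¬k
    g-injective x y (no _)  (no _)  eq = eq

    f-injective : ∀ {x y} → f x ≡ f y → x ≡ y
    f-injective {inj₁ k} {inj₁ l} eq =
      cong inj₁ (ℕₚ.*-cancelˡ-≡ k l 2 (ℕₚ.suc-injective (injective e eq)))
    f-injective {inj₁ k} {inj₂ y} eq = contradiction eq (od≢g k y em)
    f-injective {inj₂ x} {inj₁ l} eq = contradiction (sym eq) (od≢g l x em)
    f-injective {inj₂ x} {inj₂ y} eq = cong inj₂ (g-injective x y em em eq)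

  -- Hessenberg's theorem and the regularity of successor cardinals

  Idempotent : Set a → Set a
  Idempotent A = (A × A) ↣ A

  module _ (W : WellOrder ℓ) where
    open WellOrder W

    private
      max : ⟦ W ⟧ × ⟦ W ⟧ → ⟦ W ⟧
      max (x , y) = proj₁ (upperBound₂ x y)

    -- Gödel's well-order of pairs: by maximum first, then lexicographically. This confines each
    -- proper segment to a square.
    gödel-wo : WellOrder ℓ
    gödel-wo = pullback (lex-wo W (lex-wo W W))
      (mk↣ {to = λ p → max p , p} (cong proj₂))

    gödel-segment : ∀ p → ∃[ m ] ∀ (s : Seg gödel-wo p) →
                    m ≮ proj₁ (value s) × m ≮ proj₂ (value s)
    gödel-segment p = max p , λ s →
      let (x≤ , y≤) = proj₂ (upperBound₂ (proj₁ (value s)) (proj₂ (value s)))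
          ≤m        = max≤ (value s) (below gödel-wo s)
      in (λ m<x → ≤m (<-≮-trans m<x x≤)) , (λ m<y → ≤m (<-≮-trans m<y y≤))
      where
      max≤ : ∀ q → WellOrder._<_ gödel-wo q p → max p ≮ max q
      max≤ q (inj₁ q<p)       = <-asym q<p
      max≤ q (inj₂ (q≡p , _)) p<q = <-irrefl (subst (_< max q) (sym q≡p) p<q)

  -- The summand ℕ absorbs the greatest point of a closed segment, so that finite
  -- segments need no separate treatment.
  hessenberg-ℕ⊎ : (W : WellOrder ℓ) → Idempotent (ℕ ⊎ ⟦ W ⟧)
  hessenberg-ℕ⊎ {ℓ} W = step W λ x → All.wfRec (WellOrder.wellFounded W) _
      (λ x → Idempotent (ℕ ⊎ Seg W x))
      (λ x ih → step (Seg-wo W x) λ s →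
        let flatten   = ↣-id ℕ ⊎-↣ Seg-flatten W s
            unflatten = ↣-id ℕ ⊎-↣ Seg-unflatten W s
        in unflatten ↣∘ ih (below W s) ↣∘ (flatten ×-↣ flatten)) x
    where
    step : (V : WellOrder ℓ) → (∀ x → Idempotent (ℕ ⊎ Seg V x)) → Idempotent (ℕ ⊎ ⟦ V ⟧)
    step V ih with dichotomy (gödel-wo (ℕ⊎-wo V)) (ℕ ⊎ ⟦ V ⟧)
    ... | inj₁ V²↣V = V²↣V
    ... | inj₂ (p , V↣) = by-bound (gödel-segment (ℕ⊎-wo V) p)
      where
      open WellOrder V using (_<_; compare)
      open WellOrder (ℕ⊎-wo V) using (_≮_)
      Pairs = Seg (gödel-wo (ℕ⊎-wo V)) p

      -- The segment of pairs into which ℕ ⊎ V embeds is itself embedded in `C` × `C`. Idempotence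
      -- of `C` therefore embeds ℕ ⊎ V in `C`, and then its square as well.
      conclude : {C : Set c} → Idempotent C → C ↣ (ℕ ⊎ ⟦ V ⟧) →
                 ∀ m → (∀ (s : Pairs) → m ≮ proj₁ (value s) × m ≮ proj₂ (value s)) →
                 (f : ℕ ⊎ ⟦ V ⟧ → C) → (∀ x y → m ≮ x → m ≮ y → f x ≡ f y → x ≡ y) →
                 Idempotent (ℕ ⊎ ⟦ V ⟧)
      conclude {C = C} idem emb m bound f f-injective = emb ↣∘ idem ↣∘ (V↣C ×-↣ V↣C)
        where
        Pairs↣C² : Pairs ↣ (C × C)
        Pairs↣C² = mk↣ {to = λ s → f (proj₁ (value s)) , f (proj₂ (value s))} λ {s} {t} eq →
          injective (value-injection _ p) (cong₂ _,_
            (f-injective _ _ (proj₁ (bound s)) (proj₁ (bound t)) (cong proj₁ eq))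
            (f-injective _ _ (proj₂ (bound s)) (proj₂ (bound t)) (cong proj₂ eq)))
        V↣C = idem ↣∘ Pairs↣C² ↣∘ V↣

      by-bound : (∃[ m ] ∀ (s : Pairs) → m ≮ proj₁ (value s) × m ≮ proj₂ (value s)) →
                 Idempotent (ℕ ⊎ ⟦ V ⟧)
      by-bound (inj₁ k , bound) =
        conclude pairing (mk↣ inj₁-injective) (inj₁ k) bound clip clip-injective
        where
        clip : ℕ ⊎ ⟦ V ⟧ → ℕ
        clip (inj₁ n) = n
        clip (inj₂ _) = 0

        clip-injective : ∀ x y → inj₁ k ≮ x → inj₁ k ≮ y → clip x ≡ clip y → x ≡ y
        clip-injective (inj₁ m) (inj₁ n) _  _  eq = cong inj₁ eq
        clip-injective (inj₂ x) _        ≤k _  _  = contradiction ₁∼₂ ≤k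
        clip-injective (inj₁ m) (inj₂ y) _  ≤k _  = contradiction ₁∼₂ ≤k
      by-bound (inj₂ z , bound) =
        conclude (ih z) (↣-id ℕ ⊎-↣ value-injection V z) (inj₂ z) bound clip clip-injective
        where
        clip₂ : ∀ x → Tri (x < z) (x ≡ z) (z < x) → ℕ ⊎ Seg V z
        clip₂ x (tri< x<z _ _) = inj₂ (seg x x<z)
        clip₂ x _              = inj₁ 0

        clip : ℕ ⊎ ⟦ V ⟧ → ℕ ⊎ Seg V z
        -- The shift frees `inj₁ 0` for the greatest point `z` of the closed segment.
        clip (inj₁ n) = inj₁ (suc n)
        clip (inj₂ x) = clip₂ x (compare x z)

        suc≢clip₂ : ∀ n x t → inj₁ (suc n) ≢ clip₂ x t
        suc≢clip₂ n x (tri< _ _ _) ()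
        suc≢clip₂ n x (tri≈ _ _ _) ()
        suc≢clip₂ n x (tri> _ _ _) ()

        clip₂-injective : ∀ x y t u → inj₂ z ≮ inj₂ x → inj₂ z ≮ inj₂ y →
                          clip₂ x t ≡ clip₂ y u → x ≡ y
        clip₂-injective x y (tri< _ _ _)    (tri< _ _ _)    _  _  refl = refl
        clip₂-injective x y (tri≈ _ refl _) (tri≈ _ refl _) _  _  _    = refl
        clip₂-injective x y (tri> _ _ z<x)  _               ≤z _  _    = contradiction (₂∼₂ z<x) ≤z
        clip₂-injective x y _               (tri> _ _ z<y)  _  ≤z _    = contradiction (₂∼₂ z<y) ≤z

        clip-injective : ∀ x y → inj₂ z ≮ x → inj₂ z ≮ y → clip x ≡ clip y → x ≡ y
        clip-injective (inj₁ m) (inj₁ n) _ _ refl = refl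
        clip-injective (inj₁ m) (inj₂ y) _ _ eq   = contradiction eq (suc≢clip₂ m y _)
        clip-injective (inj₂ x) (inj₁ n) _ _ eq   = contradiction (sym eq) (suc≢clip₂ n x _)
        clip-injective (inj₂ x) (inj₂ y) p q eq   = cong inj₂ (clip₂-injective x y _ _ p q eq)

  abstract
    hessenberg : (W : WellOrder ℓ) → ℕ ↣ ⟦ W ⟧ → Idempotent ⟦ W ⟧
    hessenberg W e = ℕ⊎-absorb e ↣∘ hessenberg-ℕ⊎ W ↣∘ (mk↣ inj₂-injective ×-↣ mk↣ inj₂-injective)

  module _ {W : WellOrder ℓ} {A : Set a} (successor : IsSuccessorOf A W)
           (ℕ↣A : ℕ ↣ A) (idem : Idempotent A) where
    open WellOrder W
    open IsSuccessorOf successor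

    -- A greatest point would leave only itself outside its segment, and an infinite `A` has room
    -- for one more element.
    successor-limit : ∀ x → ∃[ y ] x < y
    successor-limit x = byContradiction λ none → larger
      (ℕ⊎-absorb ℕ↣A ↣∘ (↣-id ℕ ⊎-↣ segments x) ↣∘ mk↣ {to = λ y → place y (compare y x)}
        λ {y} {z} → place-injective (λ y x<y → none (y , x<y)) y z _ _)
      where
      place : ∀ y → Tri (y < x) (y ≡ x) (x < y) → ℕ ⊎ Seg W x
      place y (tri< y<x _ _) = inj₂ (seg y y<x)
      place y _              = inj₁ 0

      place-injective : (∀ y → x ≮ y) → ∀ y z t u → place y t ≡ place z u → y ≡ z
      place-injective max y z (tri< _ _ _)    (tri< _ _ _)    refl = refl
      place-injective max y z (tri≈ _ refl _) (tri≈ _ refl _) _    = refl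
      place-injective max y z (tri> _ _ x<y)  _               _    = contradiction x<y (max y)
      place-injective max y z _               (tri> _ _ x<z)  _    = contradiction x<z (max z)

    -- An unbounded family would cover `W` by segments, indexed by a subset of `A` and each embedded
    -- in `A`, so that `W` would embed in `A` × `A`.
    successor-bounded : {J : Set b} → J ↣ A → (g : J → ⟦ W ⟧) → Bounded W g
    successor-bounded J↣A g = byContradiction λ unbounded →
      let
        weakly : ∀ x → ∃[ j ] x < g j
        weakly x = let (y , x<y) = successor-limit x
                       (j , gj≮y) = ¬∀⟶∃¬ (λ all → unbounded (y , all))
                   in j , <-≮-trans x<y gj≮y
        j = λ x → proj₁ (weakly x)
      in larger (idem ↣∘ mk↣ {to = λ x →
             to J↣A (j x) , to (segments (g (j x))) (seg x (proj₂ (weakly x)))}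
           λ {x} {y} eq → same (j x) (j y) (proj₂ (weakly x)) (proj₂ (weakly y))
             (injective J↣A (cong proj₁ eq)) (cong proj₂ eq))
      where
      same : ∀ i j {x y} (x< : x < g i) (y< : y < g j) → i ≡ j →
             to (segments (g i)) (seg x x<) ≡ to (segments (g j)) (seg y y<) → x ≡ y
      same i .i x< y< refl eq = cong value (injective (segments (g i)) eq)

  successor-extends : (V : WellOrder a) {W : WellOrder ℓ} → IsSuccessorOf ⟦ V ⟧ W → ⟦ V ⟧ ↣ ⟦ W ⟧
  successor-extends V {W} successor with dichotomy V ⟦ W ⟧
  ... | inj₁ V↣W       = V↣W
  ... | inj₂ (x , W↣x) =
    contradiction (value-injection V x ↣∘ W↣x) (IsSuccessorOf.larger successor)

  successor-exists : (L : WellOrder ℓ) (A : Set a) → ¬ (∀ x → Seg L x ↣ A) →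
                     ∃[ x ] IsSuccessorOf A (Seg-wo L x)
  successor-exists L A ¬all with least L (λ x → ¬ (Seg L x ↣ A)) (¬∀⟶∃¬ ¬all)
  ... | x , larger , minimal = x , record
    { segments = λ s → byContradiction λ ¬inj → minimal (value s)
        (λ inj → ¬inj (inj ↣∘ Seg-flatten L s)) (below L s)
    ; larger   = larger
    }

  -- Ladders and club guessing

  -- Upper bounds are strict, so that no member of the family attains the supremum, not even a last
  -- one.
  IsSup : (W : WellOrder ℓ) {J : Set b} → (J → ⟦ W ⟧) → ⟦ W ⟧ → Set (ℓ ⊔ b)
  IsSup W g x = (∀ j → g j < x) × (∀ y → (∀ j → g j < y) → y ≮ x)
    where open WellOrder W

  module _ (W : WellOrder ℓ) {J : Set b} {g : J → ⟦ W ⟧} where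
    open WellOrder W

    abstract
      sup-exists : Bounded W g → ∃ (IsSup W g)
      sup-exists = least W (λ x → ∀ j → g j < x)

    sup-approached : ∀ {x} → IsSup W g x → ∀ {y} → y < x → ∃[ j ] g j ≮ y
    sup-approached (_ , minimal) y<x = ¬∀⟶∃¬ λ bound → minimal _ bound y<x

  module Ladders (V W : WellOrder ℓ) where
    private
      module V = WellOrder V
      module W = WellOrder W

    IsLadder : ⟦ W ⟧ → (⟦ V ⟧ → ⟦ W ⟧) → Set ℓ
    IsLadder x s = (∀ {v w} → v V.< w → s v W.< s w) × IsSup W s x

    -- The choice is made before any particular sequence is built, so that the recursion for the
    -- scale can refer to it. The value at points without a ladder is arbitrary.
    ladder : ⟦ W ⟧ → ⟦ V ⟧ → ⟦ W ⟧
    ladder x with em {P = ∃ (IsLadder x)}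
    ... | yes (s , _) = s
    ... | no _        = λ _ → x

    ladder-isLadder : ∀ {x s} → IsLadder x s → IsLadder x (ladder x)
    ladder-isLadder {x} {s} l with em {P = ∃ (IsLadder x)}
    ... | yes (_ , l′) = l′
    ... | no ¬l        = contradiction (s , l) ¬l

    ladder-approached : (∀ v → ∃[ w ] v V.< w) → ∀ {x s} → IsLadder x s →
                        ∀ {y} → y W.< x → ∃[ v ] y W.< s v
    ladder-approached limit (mono , sup) y<x =
      let (v , sv≮y) = sup-approached W sup y<x
          (w , v<w)  = limit v
      in w , W.≮-<-trans sv≮y (mono v<w)

  -- Shelah's club guessing at points of cofinality ℵ₁ below ℵ₃.  The closure
  -- points of functions μ → μ play the role of the clubs.
  module ClubGuessing
    (Ω I μ : WellOrder ℓ) (ℵ₁ : IsSuccessorOf ℕ Ω) (ℵ₂ : IsSuccessorOf ⟦ Ω ⟧ I)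
    (ℵ₃ : IsSuccessorOf ⟦ I ⟧ μ)
    where
    private
      module Ω = WellOrder Ω
      module I = WellOrder I

      ℕ↣Ω : ℕ ↣ ⟦ Ω ⟧
      ℕ↣Ω = successor-extends ℕ-wo ℵ₁

      Ω↣I : ⟦ Ω ⟧ ↣ ⟦ I ⟧
      Ω↣I = successor-extends Ω ℵ₂

      ℕ↣I : ℕ ↣ ⟦ I ⟧
      ℕ↣I = Ω↣I ↣∘ ℕ↣Ω

      Ω-limit : ∀ v → ∃[ w ] v Ω.< w
      Ω-limit = successor-limit ℵ₁ (↣-id ℕ) pairing

      Ω-bounded : (g : ℕ → ⟦ Ω ⟧) → Bounded Ω g
      Ω-bounded = successor-bounded ℵ₁ (↣-id ℕ) pairing (↣-id ℕ)

      I-limit : ∀ i → ∃[ j ] i I.< j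
      I-limit = successor-limit ℵ₂ ℕ↣Ω (hessenberg Ω ℕ↣Ω)

      I-bounded : (g : ⟦ Ω ⟧ → ⟦ I ⟧) → Bounded I g
      I-bounded = successor-bounded ℵ₂ ℕ↣Ω (hessenberg Ω ℕ↣Ω) (↣-id _)

      μ-limit : ∀ x → ∃[ y ] WellOrder._<_ μ x y
      μ-limit = successor-limit ℵ₃ ℕ↣I (hessenberg I ℕ↣I)

      μ-bounded : {J : Set b} → J ↣ ⟦ I ⟧ → (g : J → ⟦ μ ⟧) → Bounded μ g
      μ-bounded = successor-bounded ℵ₃ ℕ↣I (hessenberg I ℕ↣I)

    open WellOrder μ
    open Ladders Ω μ

    Closed : (⟦ μ ⟧ → ⟦ μ ⟧) → ⟦ μ ⟧ → Set ℓ
    Closed c x = ∀ y → y < x → c y < x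

    closed-antimono : ∀ {c d} → (∀ x → c x < d x) → ∀ {x} → Closed d x → Closed c x
    closed-antimono c<d closed y y<x = <-trans (c<d y) (closed y y<x)

    -- The point is the supremum of ω many steps, each of which passes `c` of everything below the
    -- previous one.
    closed-unbounded : ∀ c x → ∃[ y ] x < y × Closed c y
    closed-unbounded c x = y , proj₁ sup 0 , closed
      where
      next : ∀ u → ∃[ v ] u < v × (∀ w → w < u → c w < v)
      next u =
        let (a , u<a)  = μ-limit u
            (b , cw<b) = μ-bounded (IsSuccessorOf.segments ℵ₃ u) (c ∘ value)
            (v , a≤v , b≤v) = upperBound₂ a b
        in v , <-≮-trans u<a a≤v , λ w w<u → <-≮-trans (cw<b (seg w w<u)) b≤v

      iterate : ℕ → ⟦ μ ⟧
      iterate zero    = x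
      iterate (suc n) = proj₁ (next (iterate n))

      y   = proj₁ (sup-exists μ (μ-bounded ℕ↣I iterate))
      sup = proj₂ (sup-exists μ (μ-bounded ℕ↣I iterate))

      closed : Closed c y
      closed w w<y =
        let (n , it≮w) = sup-approached μ sup w<y
            w<next = ≮-<-trans it≮w (proj₁ (proj₂ (next (iterate n))))
        in <-trans (proj₂ (proj₂ (next (iterate (suc n)))) w w<next) (proj₁ sup (suc (suc n)))

    -- For the club C of closure points of `c`, the floor is the maximum of C ∩ (x + 1).
    IsFloor : (⟦ μ ⟧ → ⟦ μ ⟧) → ⟦ μ ⟧ → ⟦ μ ⟧ → Set ℓ
    IsFloor c x y = Closed c y × x ≮ y × (∀ z → Closed c z → x ≮ z → y ≮ z)

    -- The least upper bound y of the closure points up to `x` is itself closed: if some j < y had c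
    -- j ≥ y, no closure point up to `x` could exceed j, and j would be a smaller bound.
    floor-exists : ∀ c x → ∃ (IsFloor c x)
    floor-exists c x
      with least μ (λ y → ∀ z → Closed c z → x ≮ z → y ≮ z) (x , λ z _ x≮z → x≮z)
    ... | y , bound , minimal = y , closed , minimal x (λ z _ x≮z → x≮z) , bound
      where
      closed : Closed c y
      closed j j<y = byContradiction λ cj≮y → minimal j
        (λ z z-closed x≮z j<z → cj≮y (<-≮-trans (z-closed j j<z) (bound z z-closed x≮z))) j<y

    floor : (⟦ μ ⟧ → ⟦ μ ⟧) → ⟦ μ ⟧ → ⟦ μ ⟧
    floor c x = proj₁ (floor-exists c x)

    floor-isFloor : ∀ c x → IsFloor c x (floor c x)
    floor-isFloor c x = proj₂ (floor-exists c x)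

    -- A larger function has fewer closure points.
    floor-antimono : ∀ {c d} → (∀ x → c x < d x) → ∀ x → floor c x ≮ floor d x
    floor-antimono {c} {d} c<d x =
      let (closed , x≮floor , _) = floor-isFloor d x
      in proj₂ (proj₂ (floor-isFloor c x)) _ (closed-antimono c<d closed) x≮floor

    -- The ladder at a, pushed down to the closure points of c.
    guess : (⟦ μ ⟧ → ⟦ μ ⟧) → ⟦ μ ⟧ → ⟦ Ω ⟧ → ⟦ μ ⟧
    guess c a w = floor c (ladder a w)

    -- The set of values is uncountable, not merely the index set: a countable range would provide
    -- such a `code`.
    UncountableRange : (⟦ Ω ⟧ → ⟦ μ ⟧) → Set ℓ
    UncountableRange s = ¬ (Σ[ code ∈ (⟦ Ω ⟧ → ℕ) ] ∀ v w → code v ≡ code w → s v ≡ s w)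

    Guesses : (⟦ μ ⟧ → ⟦ μ ⟧) → (⟦ μ ⟧ → ⟦ μ ⟧) → ⟦ μ ⟧ → Set ℓ
    Guesses c d a = UncountableRange (guess c a) × (∀ w → Closed d (guess c a w))

    limit-of-closed : ∀ c → ∃[ a ] Σ[ z ∈ (⟦ Ω ⟧ → ⟦ μ ⟧) ] IsLadder a z × (∀ w → Closed c (z w))
    limit-of-closed c =
      proj₁ sup , z , ((λ {v} {w} v<w → proj₁ (z-spec w) (seg v v<w)) , proj₂ sup) , proj₂ ∘ z-spec
      where
      step : ∀ w (g : Seg Ω w → ⟦ μ ⟧) → ∃[ y ] (∀ s → g s < y) × Closed c y
      step w g =
        let (b , g<b) = μ-bounded (Ω↣I ↣∘ value-injection Ω w) g
            (y , b<y , closed) = closed-unbounded c b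
        in y , (λ s → <-trans (g<b s) b<y) , closed

      rec = recursion Ω _ step
      z = proj₁ rec
      z-spec = proj₂ rec
      sup = sup-exists μ (μ-bounded Ω↣I z)

    -- The closure points `z` are cofinal in `a`, so the floors of the chosen ladder are cofinal
    -- too, yet each lies below `a`. If there were countably many of them, each would be overtaken
    -- by a ladder point, and by regularity of ω₁ a single ladder point would bound them all.
    guess-uncountable : ∀ {c a z} → IsLadder a z → (∀ w → Closed c (z w)) →
                        UncountableRange (guess c a)
    guess-uncountable {c} {a} {z} z-ladder z-closed (code , reflects) =
      let (above , above-bounds) = Ω-bounded (λ n → proj₁ (overtaken n em))
          y = ladder a above
          (v , y<zv) = ladder-approached Ω-limit z-ladder (proj₁ (proj₂ p-ladder) above)
          (w , zv<p) = ladder-approached Ω-limit p-ladder (proj₁ (proj₂ z-ladder) v)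
          zv≤floor = proj₂ (proj₂ (floor-isFloor c (ladder a w))) (z v) (z-closed v) (<-asym zv<p)
          y<floor = <-≮-trans y<zv zv≤floor
          floor<y = <-trans (proj₂ (overtaken (code w) em) w refl) (proj₁ p-ladder (above-bounds (code w)))
      in <-asym y<floor floor<y
      where
      p-ladder = ladder-isLadder z-ladder

      guess<a : ∀ w → guess c a w < a
      guess<a w = ≮-<-trans (proj₁ (proj₂ (floor-isFloor c (ladder a w)))) (proj₁ (proj₂ p-ladder) w)

      overtaken : ∀ n → Dec (∃[ w ] code w ≡ n) →
                  ∃[ v ] ∀ w → code w ≡ n → guess c a w < ladder a v
      overtaken n (yes (w , refl)) =
        let (v , lt) = ladder-approached Ω-limit p-ladder (guess<a w)
        in v , λ w′ eq → subst (_< ladder a v) (reflects w w′ (sym eq)) lt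
      -- No index carries the code `n`, so any `v` will do.
      overtaken n (no ¬w) = proj₁ (Ω-bounded (λ _ → to ℕ↣Ω 0)) , λ w eq → contradiction (w , eq) ¬w

    -- If every c failed, a counterexample to c would be built into all later
    -- members of an I-sequence of functions c i.  Along it the floors of the
    -- points of a ladder decrease, so they are eventually constant, at an
    -- index common to the whole ladder, which lies above the counterexample.
    some-c-guesses : ¬ (∀ c → ∃[ d ] ¬ ∃ (Guesses c d))
    some-c-guesses fails = proj₂ (fails (cs i₀))
      ( α
      , guess-uncountable z-ladder (λ w → closed-antimono (c∞-above i₀) (z-closed w))
      -- By constancy the floor for `cs i₀` is also a closure point of `cs i₁`, which exceeds the
      -- alleged counterexample `Φ (cs i₀)`.
      , λ w → subst (Closed (Φ (cs i₀))) (sym (constant w))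
          (closed-antimono (proj₂ (cs-spec i₁ (seg i₀ i₀<i₁)))
            (proj₁ (floor-isFloor (cs i₁) (ladder α w)))))
      where
      Φ : (⟦ μ ⟧ → ⟦ μ ⟧) → ⟦ μ ⟧ → ⟦ μ ⟧
      Φ c = proj₁ (fails c)

      step : ∀ i (g : Seg I i → ⟦ μ ⟧ → ⟦ μ ⟧) →
             ∃[ c ] ∀ s → (∀ x → g s x < c x) × (∀ x → Φ (g s) x < c x)
      step i g =
        let bound₁ = λ x → μ-bounded (value-injection I i) (λ s → g s x)
            bound₂ = λ x → μ-bounded (value-injection I i) (λ s → Φ (g s) x)
            both = λ x → upperBound₂ (proj₁ (bound₁ x)) (proj₁ (bound₂ x))
        in (λ x → proj₁ (both x)) , λ s →
           (λ x → <-≮-trans (proj₂ (bound₁ x) s) (proj₁ (proj₂ (both x)))) ,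
           (λ x → <-≮-trans (proj₂ (bound₂ x) s) (proj₂ (proj₂ (both x))))

      cs = proj₁ (recursion I _ step)
      cs-spec = proj₂ (recursion I _ step)

      c∞ : ⟦ μ ⟧ → ⟦ μ ⟧
      c∞ x = proj₁ (μ-bounded (↣-id _) (λ i → cs i x))

      c∞-above : ∀ i x → cs i x < c∞ x
      c∞-above i x = proj₂ (μ-bounded (↣-id _) (λ i → cs i x)) i

      limit = limit-of-closed c∞
      α = proj₁ limit
      z-ladder = proj₁ (proj₂ (proj₂ limit))
      z-closed = proj₂ (proj₂ (proj₂ limit))

      stable : ∀ w → ∃[ y ] (∃[ i ] guess (cs i) α w ≡ y) ×
               (∀ x → (∃[ i ] guess (cs i) α w ≡ x) → x ≮ y)
      -- The index is arbitrary: any attained value starts the search for the least one.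
      stable w = least μ _ (_ , proj₁ (I-bounded (λ _ → to Ω↣I (to ℕ↣Ω 0))) , refl)

      stage : ⟦ Ω ⟧ → ⟦ I ⟧
      stage w = proj₁ (proj₁ (proj₂ (stable w)))

      i₀ = proj₁ (I-bounded stage)
      i₁ = proj₁ (I-limit i₀)
      i₀<i₁ = proj₂ (I-limit i₀)

      at-least : ∀ w {i} → stage w I.< i → guess (cs i) α w ≡ guess (cs (stage w)) α w
      at-least w {i} lt = ≮-antisym
        (λ less → proj₂ (proj₂ (stable w)) _ (i , refl)
          (subst (guess (cs i) α w <_) (proj₂ (proj₁ (proj₂ (stable w)))) less))
        (floor-antimono (proj₁ (cs-spec i (seg (stage w) lt))) (ladder α w))

      constant : ∀ w → guess (cs i₀) α w ≡ guess (cs i₁) α w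
      constant w =
        let lt = proj₂ (I-bounded stage) w
        in trans (at-least w lt) (sym (at-least w (I.<-trans lt i₀<i₁)))

    abstract
      club-guessing : ∃[ c ] ∀ d → ∃ (Guesses c d)
      club-guessing = byContradiction λ none → some-c-guesses λ c →
        ¬∀⟶∃¬ λ all → none (c , all)

  -- The scale

  Eventually : Pred ℕ p → Set p
  Eventually P = ∃[ m ] ∀ n → m ℕ.≤ n → P n

  eventually-× : {P : Pred ℕ a} {Q : Pred ℕ b} → Eventually P → Eventually Q →
                 Eventually (λ n → P n × Q n)
  eventually-× (k , p) (l , q) = k ℕ.⊔ l , λ n k⊔l≤n →
    p n (ℕₚ.m⊔n≤o⇒m≤o k l k⊔l≤n) , q n (ℕₚ.m⊔n≤o⇒n≤o k l k⊔l≤n)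

  eventually⇒∃ : {P : Pred ℕ p} → Eventually P → ∃ P
  eventually⇒∃ (m , p) = m , p m ℕₚ.≤-refl

  module Scale
    (L K Ω I μ : WellOrder ℓ)
    (L⁺ : IsSuccessorOf ⟦ L ⟧ K)
    (ℵ₁ : IsSuccessorOf ℕ Ω) (ℵ₂ : IsSuccessorOf ⟦ Ω ⟧ I) (ℵ₃ : IsSuccessorOf ⟦ I ⟧ μ)
    (d : ℕ → ⟦ L ⟧) (d-mono : ∀ {m n} → m ℕ.≤ n → WellOrder._≮_ L (d n) (d m))
    (d-cofinal : ∀ x → ∃[ n ] WellOrder._<_ L x (d n))
    (μ↣d : ∀ n → ⟦ μ ⟧ ↣ Seg L (d n))
    (R : ℕ → WellOrder ℓ) (d⁺ : ∀ n → IsSuccessorOf (Seg L (d n)) (R n))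
    where
    open ClubGuessing Ω I μ ℵ₁ ℵ₂ ℵ₃ using (Closed; guess; club-guessing)
    open Ladders μ K
    private
      module L = WellOrder L
      module K = WellOrder K
      module μ = WellOrder μ
      module R n = WellOrder (R n)

      ℕ↣I : ℕ ↣ ⟦ I ⟧
      ℕ↣I = successor-extends Ω ℵ₂ ↣∘ successor-extends ℕ-wo ℵ₁

      ℕ↣μ : ℕ ↣ ⟦ μ ⟧
      ℕ↣μ = successor-extends I ℵ₃ ↣∘ ℕ↣I

      μ↣L : ⟦ μ ⟧ ↣ ⟦ L ⟧
      μ↣L = value-injection L (d 0) ↣∘ μ↣d 0

      μ-limit : ∀ i → ∃[ j ] i μ.< j
      μ-limit = successor-limit ℵ₃ ℕ↣I (hessenberg I ℕ↣I)

      K-bounded : {J : Set b} → J ↣ ⟦ L ⟧ → (g : J → ⟦ K ⟧) → Bounded K g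
      K-bounded = successor-bounded L⁺ ℕ↣L (hessenberg L ℕ↣L)
        where ℕ↣L = μ↣L ↣∘ ℕ↣μ

      R-bounded : ∀ n {J : Set b} → J ↣ Seg L (d n) → (g : J → ⟦ R n ⟧) → Bounded (R n) g
      R-bounded n = successor-bounded (d⁺ n) ℕ↣d (hessenberg (Seg-wo L (d n)) ℕ↣d)
        where ℕ↣d = μ↣d n ↣∘ ℕ↣μ

    e : ∀ α → Seg K α ↣ ⟦ L ⟧
    e = IsSuccessorOf.segments L⁺

    segment-sup : (s : ⟦ μ ⟧ → ⟦ K ⟧) (i : ⟦ μ ⟧) → ∃ (IsSup K {J = Seg μ i} (s ∘ value))
    segment-sup s i = sup-exists K (K-bounded (μ↣L ↣∘ value-injection μ i) (s ∘ value))

    ladder-sup : ⟦ K ⟧ → ⟦ μ ⟧ → ⟦ K ⟧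
    ladder-sup α i = proj₁ (segment-sup (ladder α) i)

    -- For the ladder of α the values of ladder-sup α form a club of α.  Since d is
    -- cofinal, the first condition makes f increasing modulo finite sets.
    private
      Dominates : ∀ α → (Seg K α → ∀ n → ⟦ R n ⟧) → (∀ n → ⟦ R n ⟧) → Set ℓ
      Dominates α g h = ∀ n →
        (∀ s → to (e α) s L.< d n → R._<_ n (g s n) (h n)) ×
        (∀ i (lt : ladder-sup α i K.< α) → R._<_ n (g (seg (ladder-sup α i) lt) n) (h n))

      -- At coordinate n both families have at most |d n| members: the first is coded by `e α` below
      -- `d n`, the second is indexed by part of `μ`, which embeds below `d n`. Regularity of `R n`
      -- bounds them.
      dominate : ∀ α g → ∃ (Dominates α g)
      dominate α g = (λ n → proj₁ (both n)) , λ n →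
        (λ s lt → R.<-≮-trans n (proj₂ (bound₁ n) (s , [ lt ])) (proj₁ (proj₂ (both n)))) ,
        (λ i lt → R.<-≮-trans n (proj₂ (bound₂ n) (i , [ lt ])) (proj₂ (proj₂ (both n))))
        where
        bound₁ : ∀ n → Bounded (R n) {J = [ s ∈ Seg K α ∣ to (e α) s L.< d n ]} (λ (s , _) → g s n)
        bound₁ n = R-bounded n (mk↣ {to = λ { (s , [ lt ]) → seg (to (e α) s) lt }}
          λ {x} {y} → inj x y) _
          where
          inj : (x y : [ s ∈ Seg K α ∣ to (e α) s L.< d n ]) → _ → x ≡ y
          inj (s , [ _ ]) (t , [ _ ]) eq with injective (e α) {s} {t} (cong value eq)
          ... | refl = refl
        bound₂ : ∀ n → Bounded (R n) {J = [ i ∈ ⟦ μ ⟧ ∣ ladder-sup α i K.< α ]}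
                         (λ { (i , [ lt ]) → g (seg (ladder-sup α i) lt) n })
        bound₂ n = R-bounded n (μ↣d n ↣∘ mk↣ {to = Refinement.value}
          λ { {_ , [ _ ]} {_ , [ _ ]} refl → refl }) _
        both = λ n → R.upperBound₂ n (proj₁ (bound₁ n)) (proj₁ (bound₂ n))

    f : ⟦ K ⟧ → ∀ n → ⟦ R n ⟧
    f = proj₁ (recursion K Dominates dominate)

    f-dominates : ∀ α → Dominates α (f ∘ value) (f α)
    f-dominates = proj₂ (recursion K Dominates dominate)

    f-increasing : ∀ {α β} → α K.< β → Eventually (λ n → R._<_ n (f α n) (f β n))
    f-increasing {α} {β} α<β =
      let (m , lt) = d-cofinal (to (e β) (seg α α<β))
      in m , λ n m≤n → proj₁ (f-dominates β n) (seg α α<β) (L.<-≮-trans lt (d-mono m≤n))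

    -- Shelah's argument on an unbounded set of indices

    module _ {U : Pred ⟦ K ⟧ p} (U-unbounded : ∀ α → ∃[ β ] β ∈ U × α K.< β)
             (code : ⟦ K ⟧ → ℕ → ℕ)
             (reflects : ∀ {α β n} → α ∈ U → β ∈ U → code α n ≡ code β n → f α n ≡ f β n)
             where
      private
        C : ⟦ μ ⟧ → ⟦ Ω ⟧ → ⟦ μ ⟧
        C = guess (proj₁ club-guessing)

        -- In the recursion below, s j consists of the supremum ξ̄ j of the points
        -- before ξ j, and of ξ j itself.
        Covers : ∀ {i} → (Seg μ i → ⟦ K ⟧ × ⟦ K ⟧) → ⟦ μ ⟧ → ⟦ K ⟧ → Set ℓ
        Covers {i} s a σ = Eventually λ n → ∀ w (j : Seg μ i) → C a w ≡ value j →
                           R._≮_ n (f σ n) (f (proj₁ (s j)) n)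

        -- The last clause lets `ξ` anticipate the end of the construction: a cover that becomes
        -- known only later proves that one was already chosen below `ξ`.
        Step : ∀ i → (Seg μ i → ⟦ K ⟧ × ⟦ K ⟧) → ⟦ K ⟧ × ⟦ K ⟧ → Set _
        Step i s (ξ̄ , ξ) = IsSup K (proj₂ ∘ s) ξ̄ × ξ ∈ U × ξ̄ K.< ξ ×
          (∀ a → ∃ (Covers s a) → ∃[ σ ] σ K.< ξ × Covers s a σ)

        step : ∀ i s → ∃ (Step i s)
        step i s = (ξ̄ , ξ) , ξ̄-sup , ξ∈U , K.≮-<-trans ξ̄≤u u<ξ , covered
          where
          sup   = sup-exists K (K-bounded (μ↣L ↣∘ value-injection μ i) (proj₂ ∘ s))
          ξ̄     = proj₁ sup
          ξ̄-sup = proj₂ sup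

          cover : ∀ a → Dec (∃ (Covers s a)) → ⟦ K ⟧
          cover a (yes (σ , _)) = σ
          cover a (no _)        = ξ̄

          -- There is one chosen cover for each point of `μ`, hence few enough to be bounded in `K`.
          covers = K-bounded μ↣L (λ a → cover a em)
          u      = proj₁ (K.upperBound₂ ξ̄ (proj₁ covers))
          ξ̄≤u    = proj₁ (proj₂ (K.upperBound₂ ξ̄ (proj₁ covers)))
          b≤u    = proj₂ (proj₂ (K.upperBound₂ ξ̄ (proj₁ covers)))
          ξ      = proj₁ (U-unbounded u)
          ξ∈U    = proj₁ (proj₂ (U-unbounded u))
          u<ξ    = proj₂ (proj₂ (U-unbounded u))

          covered : ∀ a → ∃ (Covers s a) → ∃[ σ ] σ K.< ξ × Covers s a σ
          covered a ∃σ = cover a em , K.<-trans (K.<-≮-trans (proj₂ covers a) b≤u) u<ξ , correct em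
            where
            correct : ∀ d → Covers s a (cover a d)
            correct (yes (_ , c)) = c
            correct (no ¬∃σ)      = contradiction ∃σ ¬∃σ

        abstract
          rec : Σ[ s ∈ (⟦ μ ⟧ → ⟦ K ⟧ × ⟦ K ⟧) ] ∀ i → Step i (s ∘ value) (s i)
          rec = recursion μ Step step

        ξ̄ ξ : ⟦ μ ⟧ → ⟦ K ⟧
        ξ̄ i = proj₁ (proj₁ rec i)
        ξ i = proj₂ (proj₁ rec i)

        ξ̄-sup : ∀ i → IsSup K (ξ ∘ value) (ξ̄ i)
        ξ̄-sup i = proj₁ (proj₂ rec i)

        ξ∈U : ∀ i → ξ i ∈ U
        ξ∈U i = proj₁ (proj₂ (proj₂ rec i))

        ξ̄<ξ : ∀ i → ξ̄ i K.< ξ i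
        ξ̄<ξ i = proj₁ (proj₂ (proj₂ (proj₂ rec i)))

        ξ<ξ̄ : ∀ {i j} → i μ.< j → ξ i K.< ξ̄ j
        ξ<ξ̄ {i} {j} i<j = proj₁ (ξ̄-sup j) (seg i i<j)

        ξ-mono : ∀ {i j} → i μ.< j → ξ i K.< ξ j
        ξ-mono {i} {j} i<j = K.<-trans (ξ<ξ̄ i<j) (ξ̄<ξ j)

        δ : ⟦ K ⟧
        δ = proj₁ (sup-exists K (K-bounded μ↣L ξ))

        ξ-ladder : IsLadder δ ξ
        ξ-ladder = ξ-mono , proj₂ (sup-exists K (K-bounded μ↣L ξ))

        δ-ladder : IsLadder δ (ladder δ)
        δ-ladder = ladder-isLadder ξ-ladder

        -- Two ladders of the same point overtake each other. Where a point is closed under this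
        -- function, their initial segments have equal suprema, so this is the function to be
        -- guessed.
        interleave : ∀ i → ∃[ k ] ξ i K.< ladder δ k × ladder δ i K.< ξ k
        interleave i =
          let (k₁ , ξ<p) = ladder-approached μ-limit δ-ladder (proj₁ (proj₂ ξ-ladder) i)
              (k₂ , p<ξ) = ladder-approached μ-limit ξ-ladder (proj₁ (proj₂ δ-ladder) i)
              (m , k₁≤m , k₂≤m) = μ.upperBound₂ k₁ k₂
              (k , m<k) = μ-limit m
          in k , K.<-trans ξ<p (proj₁ δ-ladder (μ.≮-<-trans k₁≤m m<k))
               , K.<-trans p<ξ (ξ-mono (μ.≮-<-trans k₂≤m m<k))

        sups-agree : ∀ {i} → Closed (proj₁ ∘ interleave) i → ladder-sup δ i ≡ ξ̄ i
        sups-agree {i} closed = K.≮-antisym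
          (λ lt → proj₂ (ξ̄-sup i) _ (λ { (seg j j<i) →
             K.<-trans (proj₁ (proj₂ (interleave j)))
               (proj₁ (proj₂ (segment-sup (ladder δ) i)) (seg _ (closed j (recompute em j<i)))) }) lt)
          (λ lt → proj₂ (proj₂ (segment-sup (ladder δ) i)) _ (λ { (seg j j<i) →
             K.<-trans (proj₂ (proj₂ (interleave j)))
               (ξ<ξ̄ (closed j (recompute em j<i))) }) lt)

        ladder-sup<δ : ∀ i → ladder-sup δ i K.< δ
        ladder-sup<δ i = K.≮-<-trans
          (proj₂ (proj₂ (segment-sup (ladder δ) i)) _
            (λ { (seg j j<i) → proj₁ δ-ladder (recompute em j<i) }))
          (proj₁ (proj₂ δ-ladder) i)

        guessed = proj₂ club-guessing (proj₁ ∘ interleave)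
        γ = proj₁ guessed
        C-uncountable = proj₁ (proj₂ guessed)
        C-closed = proj₂ (proj₂ guessed)

        -- The point `ξ̄ (C γ w)` belongs to the club attached to `δ`, where domination holds at
        -- every coordinate, without a finite set of exceptions depending on `w`.
        ξ̄-below-δ : ∀ w n → R._<_ n (f (ξ̄ (C γ w)) n) (f δ n)
        ξ̄-below-δ w n = subst (λ α → R._<_ n (f α n) (f δ n)) (sups-agree (C-closed w))
          (proj₂ (f-dominates δ n) (C γ w) (ladder-sup<δ (C γ w)))

        δ-covers : ∀ i → Covers {i} (proj₁ rec ∘ value) γ δ
        δ-covers i = 0 , λ n _ w j eq → R.<-asym n
          (subst (λ k → R._<_ n (f (ξ̄ k) n) (f δ n)) eq (ξ̄-below-δ w n))

        -- At a common coordinate n where both hold, the values f (ξ k) n strictly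
        -- increase with k in the range of C γ.
        Above Below : ⟦ Ω ⟧ → ℕ → Set ℓ
        Above w n = ∀ v → C γ w μ.≮ C γ v → R._<_ n (f (ξ̄ (C γ v)) n) (f (ξ (C γ w)) n)
        Below w n = ∀ v → C γ w μ.< C γ v →
          ∃[ u ] C γ v μ.≮ C γ u × R._<_ n (f (ξ (C γ w)) n) (f (ξ̄ (C γ u)) n)

        -- Since `δ` covers the guess, stage `C γ w` has some σ below `ξ` that covers all its
        -- earlier points at once. One finite set of exceptional coordinates thus serves every `v`.
        above : ∀ w → Eventually (Above w)
        above w =
          let k = C γ w
              (σ , σ<ξ , covers) = proj₂ (proj₂ (proj₂ (proj₂ rec k))) γ (δ , δ-covers k)
              (m , all) = eventually-× covers (eventually-× (f-increasing σ<ξ) (f-increasing (ξ̄<ξ k)))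
          in m , λ n m≤n v k≮v → by-cases n v (all n m≤n) (μ.compare (C γ v) k) k≮v
          where
          by-cases : ∀ n v {σ} →
            (∀ u (j : Seg μ (C γ w)) → C γ u ≡ value j → R._≮_ n (f σ n) (f (ξ̄ (value j)) n)) ×
            R._<_ n (f σ n) (f (ξ (C γ w)) n) × R._<_ n (f (ξ̄ (C γ w)) n) (f (ξ (C γ w)) n) →
            Tri (C γ v μ.< C γ w) (C γ v ≡ C γ w) (C γ w μ.< C γ v) → C γ w μ.≮ C γ v →
            R._<_ n (f (ξ̄ (C γ v)) n) (f (ξ (C γ w)) n)
          by-cases n v (covers , σ<ξ , _) (tri< v<w _ _) _ =
            R.≮-<-trans n (covers v (seg (C γ v) v<w) refl) σ<ξ
          by-cases n v (_ , _ , ξ̄<ξ) (tri≈ _ v≡w _) _ =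
            subst (λ k → R._<_ n (f (ξ̄ k) n) (f (ξ (C γ w)) n)) (sym v≡w) ξ̄<ξ
          by-cases n v _ (tri> _ _ w<v) w≮v = contradiction w<v w≮v

        -- Comparing only with the next point of the guess makes the exceptional coordinates
        -- independent of `v`; this is why `Below` asks for some `u`. After a last point the
        -- condition is vacuous.
        below-next : ∀ w → Eventually (Below w)
        below-next w = by-cases em
          where
          Later : ⟦ μ ⟧ → Set ℓ
          Later k = ∃[ u ] C γ w μ.< k × C γ u ≡ k

          by-cases : Dec (∃ Later) → Eventually (Below w)
          by-cases (no ¬next) = 0 , λ n _ v w<v → contradiction (C γ v , v , w<v , refl) ¬next
          by-cases (yes next) =
            let (k , (u , w<k , u≡k) , minimal) = least μ Later next
                (m , all) = f-increasing (ξ<ξ̄ (subst (C γ w μ.<_) (sym u≡k) w<k))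
            in m , λ n m≤n v w<v →
              u , subst (C γ v μ.≮_) (sym u≡k) (minimal (C γ v) (v , w<v , refl)) , all n m≤n

        good : ∀ w → ∃[ n ] Above w n × Below w n
        good w = eventually⇒∃ (eventually-× (above w) (below-next w))

        -- The value at `ξ (C γ v)` lies below that at some `ξ̄ (C γ u)`, which lies below that at
        -- `ξ (C γ w)`, whereas equal codes make the two outer values equal.
        clash : ∀ {m n} v w → Below v m → Above w n → C γ v μ.< C γ w →
                m ≡ n → code (ξ (C γ v)) m ≡ code (ξ (C γ w)) n → ⊥
        clash {m} v w v-below w-above v<w refl code≡ =
          let (u , w≮u , lt) = v-below w v<w
              f≡ = reflects (ξ∈U (C γ v)) (ξ∈U (C γ w)) code≡
          in R.<-irrefl m (subst (R._<_ m _) (sym f≡) (R.<-trans m lt (w-above u w≮u)))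

      -- Labelling each index by a good coordinate and the code there would count the range of
      -- `C γ`.
      no-countable-trace : ⊥
      no-countable-trace = C-uncountable
        ((λ w → to pairing (label w)) , λ v w eq → same v w (injective pairing eq))
        where
        label : ⟦ Ω ⟧ → ℕ × ℕ
        label w = proj₁ (good w) , code (ξ (C γ w)) (proj₁ (good w))

        same : ∀ v w → label v ≡ label w → C γ v ≡ C γ w
        same v w eq = by-cases (μ.compare (C γ v) (C γ w))
          where
          v-good = proj₂ (good v)
          w-good = proj₂ (good w)

          by-cases : Tri (C γ v μ.< C γ w) (C γ v ≡ C γ w) (C γ w μ.< C γ v) → C γ v ≡ C γ w
          by-cases (tri< v<w _ _) =
            ⊥-elim (clash v w (proj₂ v-good) (proj₁ w-good) v<w (cong proj₁ eq) (cong proj₂ eq))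
          by-cases (tri≈ _ v≡w _) = v≡w
          by-cases (tri> _ _ w<v) =
            ⊥-elim (clash w v (proj₂ w-good) (proj₁ v-good) w<v
              (sym (cong proj₁ eq)) (sym (cong proj₂ eq)))

  -- The graph

  injective⇒infinite : {P : Pred A p} (h : ℕ ↣ A) → (∀ n → to h n ∈ P) → Infinite P
  injective⇒infinite h h∈P (xs , P⊆xs) = ℕₚ.1+n≰n (injective⇒≤ {f = position} position-injective)
    where
    at : ∀ n → to h n ∈ᴸ xs
    at n = P⊆xs (h∈P n)

    position : Fin (suc (length xs)) → Fin (length xs)
    position i = index (at (toℕ i))

    position-injective : ∀ {i j} → position i ≡ position j → i ≡ j
    position-injective {i} {j} eq = toℕ-injective (injective h
      (trans (lookup-index (at (toℕ i)))
        (trans (cong (lookup xs) eq) (sym (lookup-index (at (toℕ j)))))))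

  -- Otherwise the values of `h` up to `m` would list `P`.
  infinite⇒unbounded : {P : Pred A p} (h : ℕ → A) → Infinite P →
                       (∀ {x} → x ∈ P → ∃[ n ] x ≡ h n) →
                       ∀ m → ∃[ n ] m ℕ.< n × h n ∈ P
  infinite⇒unbounded {P = P} h P-infinite P⊆h m = byContradiction λ none →
    P-infinite (applyUpTo h (suc m) , λ {x} x∈P → listed none x∈P (P⊆h x∈P))
    where
    listed : ¬ (∃[ n ] m ℕ.< n × h n ∈ P) →
             ∀ {x} → x ∈ P → ∃[ n ] x ≡ h n → x ∈ᴸ applyUpTo h (suc m)
    listed none x∈P (n , refl) = ∈-applyUpTo⁺ h (ℕ.s≤s (ℕₚ.≮⇒≥ λ m<n → none (n , m<n , x∈P)))

  applyUpTo-agree : (f g : ℕ → A) → ∀ {m n} → applyUpTo f m ≡ applyUpTo g n →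
                    ∀ {k} → k ℕ.< m → f k ≡ g k
  applyUpTo-agree f g {suc m} {suc n} eq {zero}  _           = proj₁ (∷-injective eq)
  applyUpTo-agree f g {suc m} {suc n} eq {suc k} (ℕ.s≤s k<m) =
    applyUpTo-agree (f ∘ suc) (g ∘ suc) (proj₂ (∷-injective eq)) k<m

  -- The length is coded separately, since `encode` is shown to be injective only among lists of
  -- equal length.
  list-injection : ℕ ↣ A → Idempotent A → List A ↣ A
  list-injection {A = A} e pair = mk↣
    {to = λ xs → to pair (to e (length xs) , encode xs)} λ {xs} {ys} eq →
    let eq′ = injective pair eq
    in encode-injective xs ys (injective e (cong proj₁ eq′)) (cong proj₂ eq′)
    where
    encode : List A → A
    encode []       = to e 0
    encode (x ∷ xs) = to pair (x , encode xs)

    encode-injective : ∀ xs ys → length xs ≡ length ys → encode xs ≡ encode ys → xs ≡ ys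
    encode-injective []       []       _   _  = refl
    encode-injective (x ∷ xs) (y ∷ ys) len eq =
      let eq′ = injective pair eq
      in cong₂ _∷_ (cong proj₁ eq′) (encode-injective xs ys (ℕₚ.suc-injective len) (cong proj₂ eq′))

  -- The enumeration lists P in the order of the codes.
  hasCard : (Λ : Cardinal ℓ) {P : Pred A p} (code : A → ∣ Λ ∣) →
            (∀ {x y} → x ∈ P → y ∈ P → code x ≡ code y → x ≡ y) →
            (e : ∣ Λ ∣ ↣ A) → (∀ i → to e i ∈ P) → HasCard P Λ
  hasCard {A = A} Λ {P = P} code code-injective e e∈P =
    mk↣ f-injective , λ x → mk⇔ (surjective x) (λ { (i , refl) → f∈P i })
    where
    L = cardinal-wo Λ
    open WellOrder L
    open Cardinal Λ using (initial)

    Fresh : ∀ {i} → (Seg L i → A) → A → Set _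
    Fresh g y = y ∈ P × (∀ s → g s ≢ y)

    Next : ∀ i → (Seg L i → A) → A → Set _
    Next i g y = Fresh g y × (∀ z → Fresh g z → code z ≮ code y)

    -- If a segment exhausted `P`, the embedding `e` would carry the whole cardinal into that
    -- segment.
    fresh : ∀ i g → ∃ (Fresh {i} g)
    fresh i g = byContradiction λ none →
      let covered = λ y → byContradiction {A = ∃[ s ] g s ≡ to e y} λ ¬s →
            none (to e y , e∈P y , λ s eq → ¬s (s , eq))
          h = λ y → value (proj₁ (covered y))
      in initial i (mk↣ {to = h} (λ {y} {z} eq → injective e
           (trans (sym (proj₂ (covered y)))
             (trans (cong g (injective (value-injection L i) eq)) (proj₂ (covered z)))))
         , λ y → below L (proj₁ (covered y)))

    next : ∀ i g → ∃ (Next i g)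
    next i g =
      let (y₀ , y₀-fresh) = fresh i g
          (_ , (y , y-fresh , y≡) , minimal) =
            least L (λ k → ∃[ y ] Fresh g y × code y ≡ k) (code y₀ , y₀ , y₀-fresh , refl)
      in y , y-fresh , λ z z-fresh lt → minimal (code z) (z , z-fresh , refl) (subst (code z <_) y≡ lt)

    f : ∣ Λ ∣ → A
    f = proj₁ (recursion L Next next)

    f-next : ∀ i → Next i (f ∘ value) (f i)
    f-next = proj₂ (recursion L Next next)

    f∈P : ∀ i → f i ∈ P
    f∈P i = proj₁ (proj₁ (f-next i))

    f-injective : ∀ {i j} → f i ≡ f j → i ≡ j
    f-injective {i} {j} eq with compare i j
    ... | tri< i<j _ _ = contradiction eq (proj₂ (proj₁ (f-next j)) (seg i i<j))
    ... | tri≈ _ i≡j _ = i≡j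
    ... | tri> _ _ j<i = contradiction (sym eq) (proj₂ (proj₁ (f-next i)) (seg j j<i))

    -- A missed `x` would have a code above those of all listed elements, and `code ∘ f` would embed
    -- the cardinal in a proper segment.
    surjective : ∀ x → x ∈ P → ∃[ i ] f i ≡ x
    surjective x x∈P = byContradiction λ missed →
      let f≢x = λ i eq → missed (i , eq)
          code≤ : ∀ i → code x ≮ code (f i)
          code≤ i = proj₂ (f-next i) x (x∈P , λ s → f≢x (value s))
          code< : ∀ i → code (f i) < code x
          code< i = strict i (compare (code (f i)) (code x)) (f≢x i) (code≤ i)
      in initial (code x) (mk↣ {to = code ∘ f} (λ {i} {j} eq →
           f-injective (code-injective (f∈P i) (f∈P j) eq)) , code<)
      where
      strict : ∀ i → Tri (code (f i) < code x) (code (f i) ≡ code x) (code x < code (f i)) →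
               f i ≢ x → code x ≮ code (f i) → code (f i) < code x
      strict i (tri< lt _ _) _   _  = lt
      strict i (tri≈ _ eq _) f≢x _  = contradiction (code-injective (f∈P i) x∈P eq) f≢x
      strict i (tri> _ _ gt) _   ≤x = contradiction gt ≤x

  -- Initial ordinals and successor cardinals

  cardinal-above-segments : (Λ : Cardinal ℓ) → ∀ x → ¬ (∣ Λ ∣ ↣ Seg (cardinal-wo Λ) x)
  cardinal-above-segments Λ x g = Cardinal.initial Λ x
    (value-injection (cardinal-wo Λ) x ↣∘ g , λ y → below (cardinal-wo Λ) (to g y))

  -- The least segment of Λ⁺ that does not embed in Λ would be a cardinal ν above Λ. Minimality of
  -- Λ⁺ would then embed Λ⁺ in its own proper segment.
  cardinalSuccessor : (Λ Λ⁺ : Cardinal ℓ) → IsSuccessor Λ Λ⁺ → IsSuccessorOf ∣ Λ ∣ (cardinal-wo Λ⁺)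
  cardinalSuccessor {ℓ} Λ Λ⁺ ((_ , Λ⁺≰Λ) , smallest) = record
    { segments = λ x → byContradiction λ ¬inj →
        impossible (least K (λ x → ¬ (Seg K x ↣ ∣ Λ ∣)) (x , ¬inj))
    ; larger   = Λ⁺≰Λ
    }
    where
    L = cardinal-wo Λ
    K = cardinal-wo Λ⁺

    module _ {x} (larger : ¬ (Seg K x ↣ ∣ Λ ∣))
             (minimal : ∀ y → ¬ (Seg K y ↣ ∣ Λ ∣) → WellOrder._≮_ K y x) where
      open WellOrder (Seg-wo K x)

      ν : Cardinal ℓ
      ν = record
        { Carrier            = Carrier
        ; _<_                = _<_
        ; isStrictTotalOrder = isStrictTotalOrderᶜ record
            { isEquivalence = isEquivalence
            ; trans         = λ {x} {y} {z} → <-trans {x} {y} {z}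
            ; compare       = compare
            }
        ; wellFounded        = wellFounded
        ; initial            = λ { s (g , g<s) → minimal (value s)
            (λ inj → larger (inj ↣∘ mk↣ {to = λ y → seg (value (to g y)) (g<s y)}
              λ {y} {z} eq → injective g (injective (value-injection K x) (cong value eq)))) (below K s) }
        }

      Λ≤ν : Λ ≤ᶜ ν
      Λ≤ν with dichotomy L (Seg K x)
      ... | inj₁ L↣Seg       = L↣Seg
      ... | inj₂ (y , Seg↣L) = contradiction (value-injection L y ↣∘ Seg↣L) larger

    impossible : ¬ (∃[ x ] ¬ (Seg K x ↣ ∣ Λ ∣) ×
                      (∀ y → ¬ (Seg K y ↣ ∣ Λ ∣) → WellOrder._≮_ K y x))
    impossible (x , larger , minimal) =
      cardinal-above-segments Λ⁺ x (smallest (ν larger minimal) (Λ≤ν larger minimal , larger))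

  -- Singular cardinals of countable cofinality

  module CountableCofinality
    (Λ Λ⁺ : Cardinal ℓ) (singular : Singular Λ) (cofinality : HasCofinality Λ ℵ₀)
    (successor : IsSuccessor Λ Λ⁺)
    where
    private
      L = cardinal-wo Λ
      K = cardinal-wo Λ⁺
      module L = WellOrder L
      module K = WellOrder K

      enumeration : ℕ ↣ ∣ Λ ∣
      enumeration = let (_ , _ , (e , _)) = proj₁ cofinality in e

      κ : ℕ → ∣ Λ ∣
      κ = to enumeration

      κ-cofinal : ∀ x → ∃[ n ] κ n L.≮ x
      κ-cofinal x with proj₁ (proj₂ (proj₁ cofinality)) x
      ... | y , y∈P , x≤y with Equivalence.to (proj₂ (proj₂ (proj₂ (proj₁ cofinality))) y) y∈P
      ... | n , refl = n , ≮x x≤y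
        where
        ≮x : x L.< κ n ⊎ x ≡ κ n → κ n L.≮ x
        ≮x (inj₁ x<κn) = L.<-asym x<κn
        ≮x (inj₂ refl) = L.<-irrefl

      -- Singularity gives a cofinal set of some size ν < Λ. As ℕ embeds in every cofinal set, it
      -- embeds in ν, so a countable Λ would embed in ν.
      L⋠ℕ : ¬ (∣ Λ ∣ ↣ ℕ)
      L⋠ℕ L↣ℕ =
        let (_ , ν , ((P , P-cofinal , (p , P-range)) , _) , (_ , L⋠ν)) = singular
            (h , h∈P) = proj₂ cofinality P P-cofinal
            at = λ n → Equivalence.to (P-range (to h n)) (h∈P n)
            ℕ↣ν = mk↣ {to = λ n → proj₁ (at n)} λ {m} {n} eq → injective h
              (trans (sym (proj₂ (at m))) (trans (cong (to p) eq) (proj₂ (at n))))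
        in L⋠ν (ℕ↣ν ↣∘ L↣ℕ)

      -- Otherwise Λ itself would be the successor of `A`, hence regular, and the cofinal sequence
      -- `κ` would be bounded.
      successor-below : (A : Set a) → ℕ ↣ A → Idempotent A → ¬ (∣ Λ ∣ ↣ A) →
                        ∃[ x ] IsSuccessorOf A (Seg-wo L x)
      successor-below A ℕ↣A idem larger = successor-exists L A λ segments →
        let (b , κ<b) = successor-bounded {W = L}
              (record { segments = segments ; larger = larger }) ℕ↣A idem ℕ↣A κ
            (n , b≤κn) = κ-cofinal b
        in b≤κn (κ<b n)

      successor-above : ∀ x → ℕ ↣ Seg L x → ∃[ y ] IsSuccessorOf (Seg L x) (Seg-wo L y)
      successor-above x ℕ↣x =
        successor-below (Seg L x) ℕ↣x (hessenberg (Seg-wo L x) ℕ↣x) (cardinal-above-segments Λ x)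

      ℵ₁ : ∃[ x ] IsSuccessorOf ℕ (Seg-wo L x)
      ℵ₁ = successor-below ℕ (↣-id ℕ) pairing L⋠ℕ

      Ω = Seg-wo L (proj₁ ℵ₁)

      ℕ↣Ω : ℕ ↣ ⟦ Ω ⟧
      ℕ↣Ω = successor-extends ℕ-wo (proj₂ ℵ₁)

      ℵ₂ = successor-above (proj₁ ℵ₁) ℕ↣Ω
      I = Seg-wo L (proj₁ ℵ₂)

      ℕ↣I : ℕ ↣ ⟦ I ⟧
      ℕ↣I = successor-extends Ω (proj₂ ℵ₂) ↣∘ ℕ↣Ω

      ℵ₃ = successor-above (proj₁ ℵ₂) ℕ↣I
      μ = Seg-wo L (proj₁ ℵ₃)

      ℕ↣μ : ℕ ↣ ⟦ μ ⟧
      ℕ↣μ = successor-extends I (proj₂ ℵ₃) ↣∘ ℕ↣I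

      L-limit : ∀ x → ∃[ y ] x L.< y
      L-limit x =
        -- Passing above ω₃ makes the segment infinite, as `successor-above` requires.
        let (z , x≤z , μ≤z) = L.upperBound₂ x (proj₁ ℵ₃)
            (y , y-successor) = successor-above z (Seg-mono L μ≤z ↣∘ ℕ↣μ)
            z<y = byContradiction λ z≮y → IsSuccessorOf.larger y-successor (Seg-mono L z≮y)
        in y , L.≮-<-trans x≤z z<y

      -- The sequence starts at ω₃ so that `μ` embeds below each of its members.
      d : ℕ → ∣ Λ ∣
      d zero    = proj₁ ℵ₃
      d (suc n) = proj₁ (L.upperBound₂ (d n) (proj₁ (L-limit (κ n))))

      d-mono : ∀ {m n} → m ℕ.≤ n → d n L.≮ d m
      d-mono m≤n = by-steps (ℕₚ.≤⇒≤′ m≤n)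
        where
        by-steps : ∀ {m n} → m ℕ.≤′ n → d n L.≮ d m
        by-steps ℕ.≤′-refl              = L.<-irrefl
        by-steps (ℕ.≤′-step {n} m≤′n) lt =
          proj₁ (proj₂ (L.upperBound₂ (d n) (proj₁ (L-limit (κ n))))) (L.<-≮-trans lt (by-steps m≤′n))

      d-cofinal : ∀ x → ∃[ n ] x L.< d n
      d-cofinal x =
        let (n , x≤κn) = κ-cofinal x
            (y , κn<y) = L-limit (κ n)
        in suc n , L.<-≮-trans (L.≮-<-trans x≤κn κn<y) (proj₂ (proj₂ (L.upperBound₂ (d n) y)))

      μ↣d : ∀ n → ⟦ μ ⟧ ↣ Seg L (d n)
      μ↣d n = Seg-mono L (d-mono {n = n} ℕ.z≤n)

      d⁺ : ∀ n → ∃[ y ] IsSuccessorOf (Seg L (d n)) (Seg-wo L y)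
      d⁺ n = successor-above (d n) (μ↣d n ↣∘ ℕ↣μ)

      L⁺ : IsSuccessorOf ∣ Λ ∣ K
      L⁺ = cardinalSuccessor Λ Λ⁺ successor

      module S = Scale L K Ω I μ L⁺ (proj₂ ℵ₁) (proj₂ ℵ₂) (proj₂ ℵ₃) d d-mono d-cofinal μ↣d
                   (λ n → Seg-wo L (proj₁ (d⁺ n))) (λ n → proj₂ (d⁺ n))

      K-limit : ∀ α → ∃[ β ] α K.< β
      K-limit = successor-limit L⁺ enumeration (hessenberg L enumeration)

      -- The tree and its comparability graph

      L↣K : ∣ Λ ∣ ↣ ∣ Λ⁺ ∣
      L↣K = proj₁ (proj₁ successor)

      preimage : ∀ α → Dec (∃[ x ] to L↣K x ≡ α) → ∣ Λ ∣
      preimage α (yes (x , _)) = x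
      preimage α (no _)        = κ 0

      root : ∣ Λ⁺ ∣ → ∣ Λ ∣
      root α = preimage α em

      root-surjective : ∀ x → root (to L↣K x) ≡ x
      root-surjective x = correct em
        where
        correct : ∀ d → preimage (to L↣K x) d ≡ x
        correct (yes (_ , eq)) = injective L↣K eq
        correct (no ¬x)        = contradiction (x , refl) ¬x

    -- The first entry only serves to put all of Λ on the first level of the tree.
    branch : ∣ Λ⁺ ∣ → ℕ → ∣ Λ ∣
    branch α zero    = root α
    branch α (suc n) = value (S.f α n)

    private
      inf-injective : ∀ {g h : ℕ → ∣ Λ ∣} → inf g ≡ inf h → g ≡ h
      inf-injective refl = refl

      branches-differ : ∀ {α β} → α K.< β → inf (branch α) ≢ inf (branch β)
      branches-differ {β = β} α<β eq =
        let (n , lt) = eventually⇒∃ (S.f-increasing α<β)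
        in L.<-irrefl (subst (L._< branch β (suc n)) (cong-app (inf-injective eq) (suc n)) lt)

    top : ∣ Λ⁺ ∣ ↣ Seq ∣ Λ ∣
    top = mk↣ {to = inf ∘ branch} λ {α} {β} → by-cases (K.compare α β)
      where
      by-cases : ∀ {α β} → Tri (α K.< β) (α ≡ β) (β K.< α) →
                 inf (branch α) ≡ inf (branch β) → α ≡ β
      by-cases (tri< α<β _ _) eq = contradiction eq (branches-differ α<β)
      by-cases (tri≈ _ α≡β _) _  = α≡β
      by-cases (tri> _ _ β<α) eq = contradiction (sym eq) (branches-differ β<α)

    tree : TreeWithTops Λ Λ⁺
    tree = record
      { less = proj₁ successor
      ; X    = λ x → ∃[ α ] inf (branch α) ≡ x
      ; X⊆ω  = λ { (α , refl) → branch α , refl }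
      ; ∣X∣  = top , λ x → mk⇔ id id
      }
    open TreeWithTops tree

    ⊑-refl : (s : Seq ∣ Λ ∣) → s ⊑ s
    ⊑-refl (fin xs) = fin⊑fin (fromPointwise (Pointwise.refl refl))
    ⊑-refl (inf g)  = inf⊑inf g

    comparabilityGraph : TGraph T
    comparabilityGraph = record
      { _~_        = λ s t → s ∈ T × t ∈ T × (s ⊏ t ⊎ t ⊏ s)
      ; ~-vertices = λ (s∈T , t∈T , _) → s∈T , t∈T
      ; ~-sym      = λ { (s∈T , t∈T , s~t) → t∈T , s∈T , swap s~t }
      ; ~-irrefl   = λ { refl (_ , _ , inj₁ (_ , s≢s)) → s≢s refl
                         ; refl (_ , _ , inj₂ (_ , s≢s)) → s≢s refl }
      ; comparable = λ { (_ , _ , inj₁ (s⊑t , _)) → inj₁ s⊑t ; (_ , _ , inj₂ (t⊑s , _)) → inj₂ t⊑s }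
      ; cofinal    = λ {s} s∈T t∈T s⊏t → s , (s∈T , t∈T , inj₁ s⊏t) , s⊏t , ⊑-refl s
      }

    graph : BipartiteGraph (Seq ∣ Λ ∣)
    graph = bipartiteOf tree comparabilityGraph
    open BipartiteGraph graph

    private
      prefix : ∣ Λ⁺ ∣ → ℕ → Seq ∣ Λ ∣
      prefix α n = fin (applyUpTo (branch α) n)

      fin-injective : ∀ {xs ys : List ∣ Λ ∣} → fin xs ≡ fin ys → xs ≡ ys
      fin-injective refl = refl

      prefixes : ∣ Λ⁺ ∣ → ℕ ↣ Seq ∣ Λ ∣
      prefixes α = mk↣ {to = prefix α} λ {m} {n} eq →
        trans (sym (length-applyUpTo (branch α) m))
          (trans (cong length (fin-injective eq)) (length-applyUpTo (branch α) n))

      prefix∈T : ∀ α n → prefix α n ∈ T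
      prefix∈T α n = inf (branch α) , (α , refl) , fin⊑inf n (branch α)

      prefix-adjacent : ∀ α n → E (prefix α n) (inf (branch α))
      prefix-adjacent α n = (prefix∈T α n , _ , refl) , (α , refl) , prefix∈T α n ,
        (inf (branch α) , (α , refl) , inf⊑inf _) , inj₁ (fin⊑inf n (branch α) , λ ())

      adjacent⇒prefix : ∀ {s α} → E s (inf (branch α)) → ∃[ n ] s ≡ prefix α n
      adjacent⇒prefix (_ , _ , _ , _ , inj₁ (fin⊑inf n _ , _))   = n , refl
      adjacent⇒prefix (_ , _ , _ , _ , inj₁ (inf⊑inf _ , s≢s))   = contradiction refl s≢s
      adjacent⇒prefix (_ , _ , _ , _ , inj₂ (inf⊑inf _ , s≢s))   = contradiction refl s≢s

      ∣T<ω∣ : HasCard T<ω Λ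
      ∣T<ω∣ = hasCard Λ code code-injective (mk↣ {to = λ y → fin (y ∷ [])} λ { refl → refl }) λ y →
        subst (λ z → fin (z ∷ []) ∈ T) (root-surjective y) (prefix∈T (to L↣K y) 1) , _ , refl
        where
        lists : List ∣ Λ ∣ ↣ ∣ Λ ∣
        lists = list-injection enumeration (hessenberg L enumeration)

        code : Seq ∣ Λ ∣ → ∣ Λ ∣
        code (fin xs) = to lists xs
        code (inf _)  = κ 0

        code-injective : ∀ {s t} → s ∈ T<ω → t ∈ T<ω → code s ≡ code t → s ≡ t
        code-injective (_ , _ , refl) (_ , _ , refl) eq = cong fin (injective lists eq)

    graph-ofType : Is⟨ Λ , Λ⁺ ⟩GraphOfTypeT graph
    graph-ofType = record
      { infinite   = proj₁ singular
      ; less       = proj₁ successor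
      ; ∣A∣        = ∣T<ω∣
      ; ∣B∣        = ∣X∣
      ; neighbours = λ { (α , refl) → injective⇒infinite (prefixes α) (prefix-adjacent α) }
      } , tree , comparabilityGraph , refl

    -- A top in `H` has arbitrarily long initial segments among the countably many vertices of
    -- `H.A`. The number of a long enough one determines the entry at a given coordinate, so
    -- countably many codes suffice there.
    no-countable-subgraph : ¬ (Has⟨ ℵ₀ , Λ⁺ ⟩Subgraph graph)
    no-countable-subgraph (H , H⊆G , H-graph) = S.no-countable-trace unbounded code reflects
      where
      open _IsSubgraphOf_ H⊆G
      module H = BipartiteGraph H
      open Is⟨_,_⟩Graph H-graph using (neighbours) renaming (∣A∣ to ∣H-A∣; ∣B∣ to ∣H-B∣)

      U : Pred ∣ Λ⁺ ∣ ℓ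
      U α = inf (branch α) ∈ H.B

      -- Otherwise Λ⁺ many indices would lie in a proper segment of Λ⁺.
      unbounded : ∀ α → ∃[ β ] β ∈ U × α K.< β
      unbounded α = byContradiction λ bounded →
        let (b , b∈B) = ∣H-B∣
            at = λ i → B⊆B (Equivalence.from (b∈B (to b i)) (i , refl))
            h = λ i → proj₁ (at i)
            h∈U = λ i → subst (_∈ H.B) (sym (proj₂ (at i)))
                          (Equivalence.from (b∈B (to b i)) (i , refl))
            (β , α<β) = K-limit α
        in Cardinal.initial Λ⁺ β
             (mk↣ {to = h} (λ {i} {j} eq → injective b
               (trans (sym (proj₂ (at i))) (trans (cong (inf ∘ branch) eq) (proj₂ (at j)))))
             , λ i → K.≮-<-trans (λ α<h → bounded (h i , h∈U i , α<h)) α<β)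

      vertex : ℕ → Seq ∣ Λ ∣
      vertex = to (proj₁ ∣H-A∣)

      -- The entry `S.f α m` stands at position `suc m`, after the root, so the initial segment has
      -- to be longer than that.
      Long : ∣ Λ⁺ ∣ → ℕ → ℕ → Set ℓ
      Long α m i = ∃[ n ] suc m ℕ.< n × vertex i ≡ prefix α n

      decode : ∀ α m → Dec (∃ (Long α m)) → ℕ
      decode α m (yes (i , _)) = i
      decode α m (no _)        = 0

      code : ∣ Λ⁺ ∣ → ℕ → ℕ
      code α m = decode α m em

      long : ∀ {α} m → α ∈ U → ∃ (Long α m)
      long {α} m α∈U =
        let (n , m<n , e) = infinite⇒unbounded (prefix α) (neighbours α∈U)
                              (λ e → adjacent⇒prefix (E⊆E e)) (suc m)
            (i , eq) = Equivalence.to (proj₂ ∣H-A∣ (prefix α n)) (proj₁ (H.E⊆A×B e))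
        in i , n , m<n , eq

      code-long : ∀ {α} m → α ∈ U → Long α m (code α m)
      code-long {α} m α∈U = correct em
        where
        correct : ∀ d → Long α m (decode α m d)
        correct (yes (_ , l)) = l
        correct (no ¬l)       = contradiction (long m α∈U) ¬l

      reflects : ∀ {α β m} → α ∈ U → β ∈ U → code α m ≡ code β m → S.f α m ≡ S.f β m
      reflects {α} {β} {m} α∈U β∈U eq =
        let (_ , m<n , α-eq) = code-long m α∈U
            (_ , _   , β-eq) = code-long m β∈U
        in injective (value-injection L _) (applyUpTo-agree (branch α) (branch β)
             (fin-injective (trans (sym α-eq) (trans (cong vertex eq) β-eq))) m<n)

theorem7p1 : Classical →
    ∀ {ℓ} (Λ Λ⁺ : Cardinal ℓ) →
    Singular Λ → HasCofinality Λ ℵ₀ → IsSuccessor Λ Λ⁺ →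
    Σ[ G ∈ BipartiteGraph (Seq ∣ Λ ∣) ]
    Is⟨ Λ , Λ⁺ ⟩GraphOfTypeT G × ¬ (Has⟨ ℵ₀ , Λ⁺ ⟩Subgraph G)
theorem7p1 classical Λ Λ⁺ singular cofinality successor =
  graph , graph-ofType , no-countable-subgraph
  where open Classically.CountableCofinality classical Λ Λ⁺ singular cofinality successor
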